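{- Let $\lambda$ be a strongly inaccessible cardinal. Then $\mathrm{Bool}_\lambda$ is a Fraïssé class of length $\lambda$, i.e. it has the Joint Embedding Property and the Amalgamation Property, is closed under regular subalgebras, and is $<\lambda$-closed. Consequently there exists a Boolean algebra $\mathbb B_\lambda\in\mathrm{BoolSeq}_\lambda$ that is $\mathrm{Bool}_\lambda$-injective, and it is unique up to isomorphism among algebras in $\mathrm{BoolSeq}_\lambda$ with this property. Moreover $\mathbb B_\lambda$ is $\mathrm{Bool}_\lambda$-homogeneous: whenever $B_0,B_1\sqsubseteq\mathbb B_\lambda$ are regular subalgebras of size $<\lambda$ and $f:B_0\to B_1$ is an isomorphism, $f$ extends to an automorphism of $\mathbb B_\lambda$.
   Context: A subalgebra $A\subseteq B$ is regular (written $A\sqsubseteq B$) if every maximal antichain of $A$ is a maximal antichain of $B$; an embedding is regular if its image is a regular subalgebra. $\mathrm{Bool}_\lambda$ is the class of Boolean algebras of size $<\lambda$ with regular embeddings. Joint Embedding Property: any two members regularly embed into a common member. Amalgamation Property: for regular embeddings $f:a\to b$, $g:a\to c$ in the class there are a member $d$ and regular embeddings $f':b\to d$, $g':c\to d$ with $f'\circ f=g'\circ g$. $<\lambda$-closed: for every limit $\delta<\lambda$ and every $\sqsubseteq$-increasing continuous sequence $(A_\alpha)_{\alpha<\delta}$ of members (continuous meaning $A_\beta=\bigcup_{\alpha<\beta}A_\alpha$ for limit $\beta<\delta$), the union $\bigcup_{\alpha<\delta}A_\alpha$ is a member and each $A_\alpha$ is a regular subalgebra of it. $\mathrm{BoolSeq}_\lambda$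 is the class of Boolean algebras $A=\bigcup_{\alpha<\lambda}A_\alpha$ where each $A_\alpha\in\mathrm{Bool}_\lambda$, $A_\alpha\sqsubseteq A_\beta$ for $\alpha<\beta<\lambda$, and $A_\beta=\bigcup_{\alpha<\beta}A_\alpha$ for limit $\beta<\lambda$. A Boolean algebra $\mathbb A$ is $\mathrm{Bool}_\lambda$-injective if for all $B\sqsubseteq C$ in $\mathrm{Bool}_\lambda$ and every regular embedding $f:B\to\mathbb A$ there is a regular embedding $\bar f:C\to\mathbb A$ extending $f$. -}

module Defs where

open import Level using (Level; _⊔_; suc)
open import Algebra.Lattice.Bundles using (BooleanAlgebra)
open import Algebra.Lattice.Morphism.Structures using (IsLatticeHomomorphism)
open import Data.Bool.Base using (Bool)
open import Data.Nat.Base using (ℕ)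
open import Data.Product.Base using (Σ; ∃; ∃-syntax; Σ-syntax; _×_; _,_; proj₁; proj₂)
open import Data.Unit.Polymorphic.Base using (⊤)
open import Function.Base using (_on_)
open import Function.Bundles using (Injection)
open import Function.Definitions using (Injective; Surjective)
open import Induction.WellFounded using (WellFounded)
open import Relation.Binary.Bundles using (Setoid)
open import Relation.Binary.Core using (Rel)
open import Relation.Binary.Definitions using (Irrelevant; _Respects_)
open import Relation.Binary.PropositionalEquality.Core using (_≡_)
open import Relation.Binary.PropositionalEquality using (setoid; _→-setoid_)
open import Relation.Binary.Structures using (IsStrictTotalOrder)
open import Relation.Nullary.Negation.Core using (¬_)
open import Relation.Unary using (Pred; _∈_; _⊆_)

-- Zermelo's axiom of choice. Because sets are rendered as setoids, the choice
-- function must respect the equality of A; without that requirement the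
-- principle is already provable in type theory.
ExtensionalChoice : ∀ a e b r → Set (suc (a ⊔ e ⊔ b ⊔ r))
ExtensionalChoice a e b r =
  (A : Setoid a e) (B : Set b) (R : Setoid.Carrier A → B → Set r) →
  (∀ {x x′ y} → Setoid._≈_ A x x′ → R x y → R x′ y) →
  (∀ x → ∃[ y ] R x y) →
  Σ[ f ∈ (Setoid.Carrier A → B) ]
    (∀ {x x′} → Setoid._≈_ A x x′ → f x ≡ f x′) × (∀ x → R x (f x))

------------------------------------------------------------------------
-- Ordinals and cardinals

-- An ordinal is given by a well-ordered type, its elements being the smaller
-- ordinals. Irrelevance makes _<_ a mere relation, so that _≡_ on an initial
-- segment is equality of the underlying elements.
record WellOrder ℓ : Set (suc ℓ) where
  infix 4 _<_
  field
    Carrier            : Set ℓ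
    _<_                : Rel Carrier ℓ
    isStrictTotalOrder : IsStrictTotalOrder _≡_ _<_
    <-wellFounded      : WellFounded _<_
    <-irrelevant       : Irrelevant _<_

  Segment : Carrier → Set ℓ
  Segment α = Σ[ β ∈ Carrier ] β < α

IsLimit : ∀ {i r} {I : Set i} → Rel I r → Pred I (i ⊔ r)
IsLimit _<_ β =
  (∃[ α ] α < β) × (∀ α → α < β → ∃[ γ ] (α < γ × γ < β))

module _ {ℓ} (Λ : WellOrder ℓ) where
  open WellOrder Λ

  -- Cardinality below Λ, for Λ a cardinal: |S| ≤ |α| for some α < Λ.
  Small : ∀ {a e} → Setoid a e → Set (ℓ ⊔ a ⊔ e)
  Small S = ∃[ α ] Injection S (setoid (Segment α))

  record IsStronglyInaccessible : Set ℓ where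
    field
      isCardinal    : ¬ Small (setoid Carrier)
      isUncountable : Small (setoid ℕ)
      isRegular     : ∀ α (f : Segment α → Carrier) → ∃[ γ ] (∀ β → f β < γ)
      isStrongLimit : ∀ α → Small (Segment α →-setoid Bool)

------------------------------------------------------------------------
-- Subalgebras and regularity

module _ {ℓ} (B : BooleanAlgebra ℓ ℓ) where
  private module B = BooleanAlgebra B

  record Subalgebra : Set (suc ℓ) where
    field
      member   : Pred B.Carrier ℓ
      respects : member Respects B._≈_
      ∨-closed : ∀ {x y} → x ∈ member → y ∈ member → (x B.∨ y) ∈ member
      ∧-closed : ∀ {x y} → x ∈ member → y ∈ member → (x B.∧ y) ∈ member
      ¬-closed : ∀ {x} → x ∈ member → (B.¬ x) ∈ member
      ⊤-closed : B.⊤ ∈ member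
      ⊥-closed : B.⊥ ∈ member

    algebra : BooleanAlgebra ℓ ℓ
    algebra = record
      { Carrier = Σ B.Carrier member
      ; _≈_     = B._≈_ on proj₁
      ; _∨_     = λ (x , p) (y , q) → x B.∨ y , ∨-closed p q
      ; _∧_     = λ (x , p) (y , q) → x B.∧ y , ∧-closed p q
      ; ¬_      = λ (x , p) → B.¬ x , ¬-closed p
      ; ⊤       = B.⊤ , ⊤-closed
      ; ⊥       = B.⊥ , ⊥-closed
      ; isBooleanAlgebra = record
        { isDistributiveLattice = record
          { isLattice = record
            { isEquivalence = record
              { refl = B.refl ; sym = B.sym ; trans = B.trans }
            ; ∨-comm     = λ _ _ → B.∨-comm _ _
            ; ∨-assoc    = λ _ _ _ → B.∨-assoc _ _ _
            ; ∨-cong     = B.∨-cong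
            ; ∧-comm     = λ _ _ → B.∧-comm _ _
            ; ∧-assoc    = λ _ _ _ → B.∧-assoc _ _ _
            ; ∧-cong     = B.∧-cong
            ; absorptive = (λ _ _ → B.∨-absorbs-∧ _ _) , (λ _ _ → B.∧-absorbs-∨ _ _)
            }
          ; ∨-distrib-∧ = (λ _ _ _ → B.∨-distribˡ-∧ _ _ _) , (λ _ _ _ → B.∨-distribʳ-∧ _ _ _)
          ; ∧-distrib-∨ = (λ _ _ _ → B.∧-distribˡ-∨ _ _ _) , (λ _ _ _ → B.∧-distribʳ-∨ _ _ _)
          }
        ; ∨-complement = (λ _ → B.∨-complementˡ _) , (λ _ → B.∨-complementʳ _)
        ; ∧-complement = (λ _ → B.∧-complementˡ _) , (λ _ → B.∧-complementʳ _)
        ; ¬-cong       = B.¬-cong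
        }
      }

  whole : Subalgebra
  whole = record { member = λ _ → ⊤ }

  -- Meets and the bottom element of a subalgebra are those of B, so the
  -- antichains of V are the antichains of B contained in V.
  record IsAntichain (V : Subalgebra) (S : Pred B.Carrier ℓ) : Set ℓ where
    field
      contained : S ⊆ Subalgebra.member V
      respects  : S Respects B._≈_
      nonzero   : ∀ {x} → x ∈ S → x B.≉ B.⊥
      disjoint  : ∀ {x y} → x ∈ S → y ∈ S → x B.≉ y → (x B.∧ y) B.≈ B.⊥

  IsMaximalAntichain : Subalgebra → Pred B.Carrier ℓ → Set (suc ℓ)
  IsMaximalAntichain V S =
    IsAntichain V S × (∀ T → IsAntichain V T → S ⊆ T → T ⊆ S)

  infix 4 _⊑_
  _⊑_ : Subalgebra → Subalgebra → Set (suc ℓ)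
  V ⊑ W =
    Subalgebra.member V ⊆ Subalgebra.member W ×
    (∀ S → IsMaximalAntichain V S → IsMaximalAntichain W S)

  IsRegular : Subalgebra → Set (suc ℓ)
  IsRegular V = V ⊑ whole

------------------------------------------------------------------------
-- Morphisms

module _ {ℓ} (A B : BooleanAlgebra ℓ ℓ) where
  private
    module A = BooleanAlgebra A
    module B = BooleanAlgebra B

  record IsBooleanHomomorphism (f : A.Carrier → B.Carrier) : Set ℓ where
    field
      isLatticeHomomorphism : IsLatticeHomomorphism A.rawLattice B.rawLattice f
      ¬-homo                : ∀ x → f (A.¬ x) B.≈ B.¬ (f x)
      ⊤-homo                : f A.⊤ B.≈ B.⊤
      ⊥-homo                : f A.⊥ B.≈ B.⊥

    open IsLatticeHomomorphism isLatticeHomomorphism public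

  record Embedding : Set ℓ where
    field
      to                    : A.Carrier → B.Carrier
      isBooleanHomomorphism : IsBooleanHomomorphism to
      injective             : Injective A._≈_ B._≈_ to

    open IsBooleanHomomorphism isBooleanHomomorphism public

    image : Subalgebra B
    image = record
      { member   = λ y → ∃[ x ] to x B.≈ y
      ; respects = λ y≈z (x , p) → x , B.trans p y≈z
      ; ∨-closed = λ (x , p) (y , q) → x A.∨ y , B.trans (∨-homo x y) (B.∨-cong p q)
      ; ∧-closed = λ (x , p) (y , q) → x A.∧ y , B.trans (∧-homo x y) (B.∧-cong p q)
      ; ¬-closed = λ (x , p) → A.¬ x , B.trans (¬-homo x) (B.¬-cong p)
      ; ⊤-closed = A.⊤ , ⊤-homo
      ; ⊥-closed = A.⊥ , ⊥-homo
      }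

  record RegularEmbedding : Set (suc ℓ) where
    field
      embedding : Embedding
      isRegular : IsRegular B (Embedding.image embedding)

    open Embedding embedding public

  record Isomorphism : Set ℓ where
    field
      embedding  : Embedding
      surjective : Surjective A._≈_ B._≈_ (Embedding.to embedding)

    open Embedding embedding public

------------------------------------------------------------------------
-- Increasing sequences

-- A sequence indexed by (I , _<_), with inclusions Aα ⊑ Aβ rendered as
-- coherent regular embeddings.
record Sequence {ℓ} {I : Set ℓ} (_<_ : Rel I ℓ) : Set (suc ℓ) where
  field
    alg    : I → BooleanAlgebra ℓ ℓ
    incl   : ∀ {α β} → α < β → RegularEmbedding (alg α) (alg β)
    incl-∘ : ∀ {α β γ} (p : α < β) (q : β < γ) (r : α < γ) x →
             BooleanAlgebra._≈_ (alg γ)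
               (RegularEmbedding.to (incl q) (RegularEmbedding.to (incl p) x))
               (RegularEmbedding.to (incl r) x)

  IsContinuous : Set ℓ
  IsContinuous = ∀ β → IsLimit _<_ β → ∀ y →
    ∃[ α ] Σ[ p ∈ α < β ] ∃[ x ]
      BooleanAlgebra._≈_ (alg β) (RegularEmbedding.to (incl p) x) y

  -- D is the union of the sequence. The inclusions into D are embeddings that
  -- are not required to be regular.
  record IsUnion (D : BooleanAlgebra ℓ ℓ) : Set ℓ where
    private module D = BooleanAlgebra D
    field
      inj      : ∀ α → Embedding (alg α) D
      inj-incl : ∀ {α β} (p : α < β) x →
                 Embedding.to (inj β) (RegularEmbedding.to (incl p) x)
                   D.≈ Embedding.to (inj α) x
      covers   : ∀ y → ∃[ α ] ∃[ x ] Embedding.to (inj α) x D.≈ y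

------------------------------------------------------------------------
-- The classes Bool_λ and BoolSeq_λ

module _ {ℓ} (Λ : WellOrder ℓ) where
  open WellOrder Λ using (_<_; Segment) renaming (Carrier to Ord)

  -- Boolean algebras are nondegenerate, as usual: the one-element algebra
  -- embeds only into itself, which would refute joint embedding.
  InBool : BooleanAlgebra ℓ ℓ → Set ℓ
  InBool A = BooleanAlgebra._≉_ A (BooleanAlgebra.⊤ A) (BooleanAlgebra.⊥ A)
           × Small Λ (BooleanAlgebra.setoid A)

  JointEmbedding : Set (suc ℓ)
  JointEmbedding = ∀ A B → InBool A → InBool B →
    ∃[ D ] (InBool D × RegularEmbedding A D × RegularEmbedding B D)

  Amalgamation : Set (suc ℓ)
  Amalgamation = ∀ A B C → InBool A → InBool B → InBool C →
    (f : RegularEmbedding A B) (g : RegularEmbedding A C) →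
    ∃[ D ] (InBool D ×
      Σ[ f′ ∈ RegularEmbedding B D ] Σ[ g′ ∈ RegularEmbedding C D ]
        (∀ x → BooleanAlgebra._≈_ D
                 (RegularEmbedding.to f′ (RegularEmbedding.to f x))
                 (RegularEmbedding.to g′ (RegularEmbedding.to g x))))

  ClosedUnderRegularSubalgebras : Set (suc ℓ)
  ClosedUnderRegularSubalgebras = ∀ B → InBool B →
    (V : Subalgebra B) → IsRegular B V → InBool (Subalgebra.algebra V)

  ClosedUnderUnions : Set (suc ℓ)
  ClosedUnderUnions = ∀ δ → IsLimit _<_ δ →
    (A : Sequence {I = Segment δ} (_<_ on proj₁)) →
    (∀ α → InBool (Sequence.alg A α)) → Sequence.IsContinuous A →
    (∃[ D ] Sequence.IsUnion A D) ×
    (∀ D (u : Sequence.IsUnion A D) →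
      InBool D ×
      (∀ α → IsRegular D (Embedding.image (Sequence.IsUnion.inj u α))))

  record IsFraïsséClass : Set (suc ℓ) where
    field
      jointEmbedding                : JointEmbedding
      amalgamation                  : Amalgamation
      closedUnderRegularSubalgebras : ClosedUnderRegularSubalgebras
      closedUnderUnions             : ClosedUnderUnions

  record InBoolSeq (A : BooleanAlgebra ℓ ℓ) : Set (suc ℓ) where
    field
      sub        : Ord → Subalgebra A
      inBool     : ∀ α → InBool (Subalgebra.algebra (sub α))
      increasing : ∀ {α β} → α < β → _⊑_ A (sub α) (sub β)
      continuous : ∀ β → IsLimit _<_ β → ∀ {x} → x ∈ Subalgebra.member (sub β) →
                   ∃[ α ] (α < β × x ∈ Subalgebra.member (sub α))
      covers     : ∀ x → ∃[ α ] x ∈ Subalgebra.member (sub α)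

  IsInjective : BooleanAlgebra ℓ ℓ → Set (suc ℓ)
  IsInjective 𝔸 = ∀ C (B : Subalgebra C) →
    InBool (Subalgebra.algebra B) → InBool C → IsRegular C B →
    (f : RegularEmbedding (Subalgebra.algebra B) 𝔸) →
    Σ[ f̄ ∈ RegularEmbedding C 𝔸 ]
      (∀ x → BooleanAlgebra._≈_ 𝔸
               (RegularEmbedding.to f̄ (proj₁ x)) (RegularEmbedding.to f x))

  IsHomogeneous : BooleanAlgebra ℓ ℓ → Set (suc ℓ)
  IsHomogeneous 𝔸 = (B₀ B₁ : Subalgebra 𝔸) → IsRegular 𝔸 B₀ → IsRegular 𝔸 B₁ →
    Small Λ (BooleanAlgebra.setoid (Subalgebra.algebra B₀)) →
    Small Λ (BooleanAlgebra.setoid (Subalgebra.algebra B₁)) →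
    (f : Isomorphism (Subalgebra.algebra B₀) (Subalgebra.algebra B₁)) →
    Σ[ g ∈ Isomorphism 𝔸 𝔸 ]
      (∀ x → BooleanAlgebra._≈_ 𝔸
               (Isomorphism.to g (proj₁ x)) (proj₁ (Isomorphism.to f x)))

{-# OPTIONS --safe #-}
module Submission where

-- A subalgebra V of B is regular as soon as every nonzero w in B has a reduction in V: a nonzero
-- v such that every x in V disjoint from w is disjoint from v; for small V the converse holds.
-- The algebra 𝔹 is written down directly: it is the union over α < λ of the regular open
-- algebras of the posets P_α that collapse all β < α to ω with finite conditions. It is injective
-- because the collapse absorbs small algebras: given B ⊑ C and B → 𝔹 with image supported on P_α,
-- pick a coordinate β > α large enough to code C. A list of elements of C read off that coordinate
-- traces a descending path in the quotient of C by the generic filter of B, and this path is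
-- generic. Joint embedding and amalgamation follow by embedding everything into 𝔹 and passing to a
-- stage of its filtration. Uniqueness and homogeneity come from a back-and-forth of length λ between
-- filtrations; at limits, continuity makes domain and range stages of the filtrations, hence regular.

open import Defs
open import Level using (Level; _⊔_; suc)
open import Algebra.Lattice.Bundles using (BooleanAlgebra)
import Algebra.Lattice.Properties.BooleanAlgebra as BooleanAlgebraProperties
open import Algebra.Lattice.Structures using (IsBooleanAlgebra)
open import Algebra.Lattice.Structures.Biased using (isBooleanAlgebraʳ)
open import Axiom.ExcludedMiddle using (ExcludedMiddle)
open import Data.Bool.Base using (Bool; true; false; T)
open import Data.Empty.Polymorphic using () renaming (⊥ to Empty)
open import Data.List.Base using (List; []; _∷_; _++_; filter; map; concatMap)
open import Data.List.Properties using (++-assoc; ++-identityʳ; filter-++; filter-reject; concatMap-++)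
open import Data.Maybe.Base using (Maybe; just; nothing)
open import Data.Maybe.Properties using (just-injective)
open import Data.Nat.Base using (ℕ; zero) renaming (suc to sucℕ)
open import Data.Product.Base using (Σ; ∃; ∃-syntax; Σ-syntax; _×_; _,_; proj₁; proj₂)
open import Data.Product.Properties using (Σ-≡,≡→≡)
open import Data.Sum.Base using (_⊎_; inj₁; inj₂; [_,_]′)
open import Data.Unit.Polymorphic.Base using (tt) renaming (⊤ to Unit)
open import Function.Base using (_∘_; _on_; flip)
open import Function.Bundles using (Injection)
open import Function.Construct.Composition using (injection)
open import Induction.WellFounded using (Acc; acc)
open import Relation.Binary.Bundles using (Setoid)
open import Relation.Binary.Core using (Rel)
open import Relation.Binary.Definitions using (tri<; tri≈; tri>)
import Relation.Binary.Lattice as OrderTheory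
import Relation.Binary.Lattice.Properties.DistributiveLattice as OrderDistributiveLatticeProperties
import Relation.Binary.Lattice.Properties.HeytingAlgebra as HeytingAlgebraProperties
import Relation.Binary.Lattice.Properties.Lattice as OrderLatticeProperties
open import Relation.Binary.PropositionalEquality as ≡ using (_≡_; _→-setoid_)
import Relation.Binary.Reasoning.Setoid as SetoidReasoning
open import Relation.Binary.Structures using (IsStrictTotalOrder)
open import Relation.Nullary.Decidable using (Dec; yes; no; ⌊_⌋; toWitness; fromWitness; decidable-stable)
open import Relation.Nullary.Negation.Core using (¬_; contradiction)
open import Relation.Unary using (Pred; _∈_; _⊆_; _∪_)

-- Maximal antichains quantify over all subsets and transport badly along maps. Reductions are
-- pointwise, compose, and survive cutting the ambient algebra down to a subalgebra that contains
-- the elements involved. Every regularity argument therefore runs on them, and antichains occur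
-- only in the two translations, one of which uses smallness to build an antichain along a
-- well-order. The obstacle in the absorption step is that a condition need not decide which
-- elements of C are compatible with the generic filter of B. Such decisions can always be made on
-- coordinates below α, which the path at β > α does not read, so the path stands still while its
-- next move is settled. Since every element of C has an entry at β, each permitted move is a
-- one-entry extension, and this makes the path generic. The strong limit property keeps the regular
-- open algebras of the P_α below λ; regularity of λ bounds supports, stages and unions. Choice is
-- used to code unions of chains and to select the steps of the back-and-forth; both times it has to
-- respect an equality.

module BooleanOrder {a b} (B : BooleanAlgebra a b) where
  open BooleanAlgebra B renaming (¬_ to ∁_)
  open BooleanAlgebraProperties B public
    using (∧-idem; ∨-idem; ∧-identityˡ; ∧-identityʳ; ∨-identityˡ; ∨-identityʳ; ∧-zeroˡ; ∧-zeroʳ;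
           ¬⊥≈⊤; ¬⊤≈⊥; ¬-involutive; deMorgan₂)
  open BooleanAlgebraProperties B using (∨-∧-orderTheoreticLattice)
  open OrderTheory.Lattice ∨-∧-orderTheoreticLattice public
    using (_≤_; antisym; x∧y≤x; x∧y≤y; ∧-greatest; x≤x∨y; y≤x∨y; ∨-least)
    renaming (refl to ≤-refl; trans to ≤-trans; reflexive to ≤-reflexive)
  open SetoidReasoning setoid

  ⊥-least : ∀ x → ⊥ ≤ x
  ⊥-least x = sym (∧-zeroˡ x)

  ⊤-greatest : ∀ x → x ≤ ⊤
  ⊤-greatest x = sym (∧-identityʳ x)

  ≤⊥⇒≈⊥ : ∀ {x} → x ≤ ⊥ → x ≈ ⊥
  ≤⊥⇒≈⊥ x≤⊥ = antisym x≤⊥ (⊥-least _)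

  disjoint-≤ : ∀ {x x′ y y′} → x ≤ x′ → y ≤ y′ → x′ ∧ y′ ≈ ⊥ → x ∧ y ≈ ⊥
  disjoint-≤ x≤x′ y≤y′ eq = ≤⊥⇒≈⊥ (≤-trans
    (∧-greatest (≤-trans (x∧y≤x _ _) x≤x′) (≤-trans (x∧y≤y _ _) y≤y′)) (≤-reflexive eq))

  ∧-disjoint : ∀ {x y} → x ≤ y → x ∧ y ≈ ⊥ → x ≈ ⊥
  ∧-disjoint x≤y eq = trans x≤y eq

  ∧-complement-split : ∀ {x y u v} → x ∧ y ≤ u → x ∧ ∁ y ≤ v → x ≤ u ∨ v
  ∧-complement-split {x} {y} p q = ≤-trans (≤-reflexive (begin
    x                      ≈⟨ ∧-identityʳ x ⟨
    x ∧ ⊤                  ≈⟨ ∧-congˡ (∨-complementʳ y) ⟨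
    x ∧ (y ∨ ∁ y)          ≈⟨ ∧-distribˡ-∨ x y (∁ y) ⟩
    (x ∧ y) ∨ (x ∧ ∁ y)    ∎))
    (∨-least (≤-trans p (x≤x∨y _ _)) (≤-trans q (y≤x∨y _ _)))

  curry-∧ : ∀ {x y z} → x ∧ y ≤ z → x ≤ (∁ y) ∨ z
  curry-∧ p = ≤-trans (∧-complement-split p (x∧y≤y _ _)) (≤-reflexive (∨-comm _ _))

  modus-ponens : ∀ {x y} → ((∁ x) ∨ y) ∧ x ≤ y
  modus-ponens {x} {y} = ≤-trans (≤-reflexive (begin
    ((∁ x) ∨ y) ∧ x          ≈⟨ ∧-distribʳ-∨ x (∁ x) y ⟩
    ((∁ x) ∧ x) ∨ (y ∧ x)    ≈⟨ ∨-congʳ (∧-complementˡ x) ⟩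
    ⊥ ∨ (y ∧ x)              ≈⟨ ∨-identityˡ _ ⟩
    y ∧ x                    ∎)) (x∧y≤x y x)

  disjoint⇒≤∁ : ∀ {x y} → x ∧ y ≈ ⊥ → x ≤ ∁ y
  disjoint⇒≤∁ {x} {y} p = ≤-trans (curry-∧ (≤-reflexive p)) (≤-reflexive (∨-identityʳ _))

  ≤∁⇒disjoint : ∀ {x y} → x ≤ ∁ y → x ∧ y ≈ ⊥
  ≤∁⇒disjoint {x} {y} p = disjoint-≤ p ≤-refl (∧-complementˡ y)

  disjoint∁⇒≤ : ∀ {x y} → x ∧ ∁ y ≈ ⊥ → x ≤ y
  disjoint∁⇒≤ p = ≤-trans (disjoint⇒≤∁ p) (≤-reflexive (¬-involutive _))

  ≤⇒disjoint∁ : ∀ {x y} → x ≤ y → x ∧ ∁ y ≈ ⊥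
  ≤⇒disjoint∁ {x} {y} p = disjoint-≤ p ≤-refl (∧-complementʳ y)

-- Regular open algebra of a preorder

module RegularOpenSets (em : ∀ {a} → ExcludedMiddle a) {e} {X : Set e}
  (_≼_ : X → X → Set e) (≼-refl : ∀ {p} → p ≼ p) (≼-trans : ∀ {p q r} → p ≼ q → q ≼ r → p ≼ r) where

  -- Membership is `Bool`-valued, which excluded middle permits. This keeps the carrier at level `e`
  -- and makes a regular open set a point of the power set `X → Bool` when algebras are counted.
  record RegularOpen : Set e where
    field
      char    : X → Bool
      open-   : ∀ {p q} → q ≼ p → T (char p) → T (char q)
      regular : ∀ {p} → (∀ {q} → q ≼ p → ∃[ r ] (r ≼ q × T (char r))) → T (char p)

  open RegularOpen public

  infix 4 _∋_ _⊆ᵣ_ _≈ᵣ_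
  _∋_ : RegularOpen → X → Set
  U ∋ p = T (char U p)

  _⊆ᵣ_ _≈ᵣ_ : RegularOpen → RegularOpen → Set e
  U ⊆ᵣ V = ∀ p → U ∋ p → V ∋ p
  U ≈ᵣ V = U ⊆ᵣ V × V ⊆ᵣ U

  DenseBelow : ∀ {l} → Pred X l → Pred X (e ⊔ l)
  DenseBelow O p = ∀ q → q ≼ p → ∃[ r ] (r ≼ q × O r)

  -- Density below p is an open and regular condition for any predicate, open or not. Predicates
  -- that are not inherited by extensions, such as `Below c` later on, can therefore generate
  -- regular open sets.
  regularize : ∀ {l} → Pred X l → RegularOpen
  regularize O = record
    { char    = λ p → ⌊ em {P = DenseBelow O p} ⌋
    ; open-   = λ q≼p d → fromWitness λ r r≼q → toWitness d r (≼-trans r≼q q≼p)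
    ; regular = λ h → fromWitness λ q q≼p →
        let r , r≼q , d = h q≼p
            s , s≼r , o = toWitness d r ≼-refl
        in s , ≼-trans s≼r r≼q , o
    }

  regularize⁺ : ∀ {l} {O : Pred X l} {p} → DenseBelow O p → regularize O ∋ p
  regularize⁺ d = fromWitness d

  regularize⁻ : ∀ {l} {O : Pred X l} {p} → regularize O ∋ p → DenseBelow O p
  regularize⁻ d = toWitness d

  regularize-least : ∀ {l} {O : Pred X l} U → (∀ p → O p → U ∋ p) → regularize O ⊆ᵣ U
  regularize-least {O = O} U O⊆U p d = regular U λ q≼p →
    let r , r≼q , o = regularize⁻ {O = O} d _ q≼p in r , r≼q , O⊆U r o

  regularize-downset : ∀ {l} {O : Pred X l} {p} → (∀ {q} → q ≼ p → O q) → regularize O ∋ p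
  regularize-downset {O = O} h = regularize⁺ {O = O} λ q q≼p → q , ≼-refl , h q≼p

  infixr 7 _∧ᵣ_
  infixr 6 _∨ᵣ_
  infixr 5 _⇨ᵣ_
  _∧ᵣ_ _∨ᵣ_ _⇨ᵣ_ : RegularOpen → RegularOpen → RegularOpen
  U ∧ᵣ V = regularize λ p → U ∋ p × V ∋ p
  U ∨ᵣ V = regularize λ p → U ∋ p ⊎ V ∋ p
  U ⇨ᵣ V = regularize λ p → ∀ {q} → q ≼ p → U ∋ q → V ∋ q

  ⊤ᵣ ⊥ᵣ : RegularOpen
  ⊤ᵣ = regularize {e} λ _ → Unit
  ⊥ᵣ = regularize {e} λ _ → Empty

  ∁ᵣ_ : RegularOpen → RegularOpen
  ∁ᵣ U = U ⇨ᵣ ⊥ᵣ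

  ∧ᵣ-intro : ∀ U V {p} → U ∋ p → V ∋ p → (U ∧ᵣ V) ∋ p
  ∧ᵣ-intro U V u v = regularize-downset {O = λ p → U ∋ p × V ∋ p} λ q≼p → open- U q≼p u , open- V q≼p v

  ∧ᵣ-elim : ∀ U V {p} → (U ∧ᵣ V) ∋ p → U ∋ p × V ∋ p
  ∧ᵣ-elim U V {p} d = regularize-least {O = λ p → U ∋ p × V ∋ p} U (λ _ → proj₁) p d
                    , regularize-least {O = λ p → U ∋ p × V ∋ p} V (λ _ → proj₂) p d

  ⇨ᵣ-intro : ∀ U V {p} → (∀ {q} → q ≼ p → U ∋ q → V ∋ q) → (U ⇨ᵣ V) ∋ p
  ⇨ᵣ-intro U V h = regularize-downset {O = λ p → ∀ {q} → q ≼ p → U ∋ q → V ∋ q} λ q≼p r≼q → h (≼-trans r≼q q≼p)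

  ⇨ᵣ-elim : ∀ U V {p} → (U ⇨ᵣ V) ∋ p → U ∋ p → V ∋ p
  ⇨ᵣ-elim U V d u = regular V λ q≼p →
    let r , r≼q , o = regularize⁻ {O = λ p → ∀ {q} → q ≼ p → U ∋ q → V ∋ q} d _ q≼p
    in r , r≼q , o ≼-refl (open- U (≼-trans r≼q q≼p) u)

  ∌⊥ᵣ : ∀ {p} → ¬ (⊥ᵣ ∋ p)
  ∌⊥ᵣ d with regularize⁻ {O = λ _ → Empty {e}} d _ ≼-refl
  ... | _ , _ , ()

  ∋⊤ᵣ : ∀ {p} → ⊤ᵣ ∋ p
  ∋⊤ᵣ = regularize-downset {e} {O = λ _ → Unit} λ _ → tt

  ∁ᵣ-intro : ∀ U {p} → (∀ {q} → q ≼ p → ¬ (U ∋ q)) → (∁ᵣ U) ∋ p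
  ∁ᵣ-intro U h = ⇨ᵣ-intro U ⊥ᵣ λ q≼p u → contradiction u (h q≼p)

  ∁ᵣ-elim : ∀ U {p} → (∁ᵣ U) ∋ p → ¬ (U ∋ p)
  ∁ᵣ-elim U d u = ∌⊥ᵣ (⇨ᵣ-elim U ⊥ᵣ d u)

  ∌⇒∁ᵣ-below : ∀ U {p} → ¬ (U ∋ p) → ∃[ q ] (q ≼ p × (∁ᵣ U) ∋ q)
  ∌⇒∁ᵣ-below U {p} p∉U with em {P = ∃[ q ] (q ≼ p × (∁ᵣ U) ∋ q)}
  ... | yes h = h
  ... | no ¬h = contradiction (regular U λ {q} q≼p → meets q≼p) p∉U
    where
    meets : ∀ {q} → q ≼ p → ∃[ r ] (r ≼ q × U ∋ r)
    meets {q} q≼p with em {P = ∃[ r ] (r ≼ q × U ∋ r)}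
    ... | yes m = m
    ... | no ¬m = contradiction (q , q≼p , ∁ᵣ-intro U λ r≼q u → ¬m (_ , r≼q , u)) ¬h

  private
    -- The exponential makes distributivity automatic, so only universal properties with respect to
    -- inclusion are checked; excluded middle then turns the Heyting algebra into a Boolean one.
    heytingAlgebra : OrderTheory.HeytingAlgebra e e e
    heytingAlgebra = record
      { Carrier = RegularOpen ; _≈_ = _≈ᵣ_ ; _≤_ = _⊆ᵣ_
      ; _∨_ = _∨ᵣ_ ; _∧_ = _∧ᵣ_ ; _⇨_ = _⇨ᵣ_ ; ⊤ = ⊤ᵣ ; ⊥ = ⊥ᵣ
      ; isHeytingAlgebra = record
        { isBoundedLattice = record
          { isLattice = record
            { isPartialOrder = record
              { isPreorder = record
                { isEquivalence = record
                  { refl  = (λ _ u → u) , (λ _ u → u)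
                  ; sym   = λ (f , g) → g , f
                  ; trans = λ (f , g) (h , k) → (λ p u → h p (f p u)) , (λ p u → g p (k p u))
                  }
                ; reflexive = proj₁
                ; trans     = λ f g p u → g p (f p u)
                }
              ; antisym = _,_
              }
            ; supremum = λ U V →
                (λ p u → regularize-downset {O = λ p → U ∋ p ⊎ V ∋ p} λ q≼p → inj₁ (open- U q≼p u)) ,
                (λ p v → regularize-downset {O = λ p → U ∋ p ⊎ V ∋ p} λ q≼p → inj₂ (open- V q≼p v)) ,
                (λ W U⊆W V⊆W → regularize-least {O = λ p → U ∋ p ⊎ V ∋ p} W λ where
                  p (inj₁ u) → U⊆W p u
                  p (inj₂ v) → V⊆W p v)
            ; infimum = λ U V →
                (λ p d → proj₁ (∧ᵣ-elim U V d)) ,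
                (λ p d → proj₂ (∧ᵣ-elim U V d)) ,
                (λ W W⊆U W⊆V p w → ∧ᵣ-intro U V (W⊆U p w) (W⊆V p w))
            }
          ; maximum = λ _ _ _ → ∋⊤ᵣ
          ; minimum = λ _ _ d → contradiction d ∌⊥ᵣ
          }
        ; exponential = λ W U V →
            (λ h p w → ⇨ᵣ-intro U V λ {q} q≼p u → h q (∧ᵣ-intro W U (open- W q≼p w) u)) ,
            (λ h p d → let w , u = ∧ᵣ-elim W U d in ⇨ᵣ-elim U V (h p w) u)
        }
      }

    module H = HeytingAlgebraProperties heytingAlgebra
    module D = OrderDistributiveLatticeProperties H.distributiveLattice

    excluded-middle : ∀ U → ⊤ᵣ ⊆ᵣ (U ∨ᵣ ∁ᵣ U)
    excluded-middle U p _ = regularize⁺ {O = λ p → U ∋ p ⊎ (∁ᵣ U) ∋ p} λ q _ → decide q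
      where
      decide : ∀ q → ∃[ r ] (r ≼ q × (U ∋ r ⊎ (∁ᵣ U) ∋ r))
      decide q with em {P = U ∋ q}
      ... | yes u = q , ≼-refl , inj₁ u
      ... | no ¬u = let r , r≼q , d = ∌⇒∁ᵣ-below U ¬u in r , r≼q , inj₂ d

  abstract
    isBooleanAlgebra : IsBooleanAlgebra _≈ᵣ_ _∨ᵣ_ _∧ᵣ_ ∁ᵣ_ ⊤ᵣ ⊥ᵣ
    isBooleanAlgebra = isBooleanAlgebraʳ record
      { isDistributiveLattice = record
        { isLattice   = OrderLatticeProperties.isAlgLattice (OrderTheory.HeytingAlgebra.lattice heytingAlgebra)
        ; ∨-distrib-∧ = D.∨-distrib-∧
        ; ∧-distrib-∨ = D.∧-distrib-∨
        }
      ; ∨-complementʳ = λ U → (λ _ _ → ∋⊤ᵣ) , excluded-middle U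
      ; ∧-complementʳ = λ U → (λ p d → let u , ¬u = ∧ᵣ-elim U (∁ᵣ U) d in contradiction u (∁ᵣ-elim U ¬u))
                            , (λ _ d → contradiction d ∌⊥ᵣ)
      ; ¬-cong        = λ {U} {V} U≈V → H.⇨-cong {U} {V} {⊥ᵣ} {⊥ᵣ} U≈V ((λ _ u → u) , (λ _ u → u))
      }

  regularOpenAlgebra : BooleanAlgebra e e
  regularOpenAlgebra = record { isBooleanAlgebra = isBooleanAlgebra }

-- Embeddings and their reductions

module _ {ℓ} {A B : BooleanAlgebra ℓ ℓ} where
  private
    module A = BooleanAlgebra A
    module B = BooleanAlgebra B
    module A≤ = BooleanOrder A
    module B≤ = BooleanOrder B

  -- Joins follow by De Morgan, and injectivity holds because f x ≈ f y puts both x ∧ ¬ y and y ∧ ¬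
  -- x into the kernel.
  mkEmbedding : (f : A.Carrier → B.Carrier) → (∀ {x y} → x A.≈ y → f x B.≈ f y) →
    (∀ x y → f (x A.∧ y) B.≈ f x B.∧ f y) → (∀ x → f (A.¬ x) B.≈ B.¬ f x) →
    (∀ x → f x B.≈ B.⊥ → x A.≈ A.⊥) → Embedding A B
  mkEmbedding f f-cong f-∧ f-¬ f-kernel = record
    { to = f
    ; isBooleanHomomorphism = record
      { isLatticeHomomorphism = record
        { isRelHomomorphism = record { cong = f-cong } ; ∧-homo = f-∧ ; ∨-homo = f-∨ }
      ; ¬-homo = f-¬ ; ⊤-homo = f-⊤ ; ⊥-homo = f-⊥ }
    ; injective = λ {x} {y} eq → A≤.antisym (reflects-≤ x y eq) (reflects-≤ y x (B.sym eq))
    }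
    where
    f-⊥ : f A.⊥ B.≈ B.⊥
    f-⊥ = B.trans (f-cong (A.sym (A.∧-complementʳ A.⊥)))
         (B.trans (f-∧ _ _) (B.trans (B.∧-congˡ (f-¬ _)) (B.∧-complementʳ _)))
    f-⊤ : f A.⊤ B.≈ B.⊤
    f-⊤ = B.trans (f-cong (A.sym A≤.¬⊥≈⊤)) (B.trans (f-¬ _) (B.trans (B.¬-cong f-⊥) B≤.¬⊥≈⊤))
    f-∨ : ∀ x y → f (x A.∨ y) B.≈ f x B.∨ f y
    f-∨ x y = B.trans (f-cong (A.trans (A.sym (A≤.¬-involutive _)) (A.¬-cong (A≤.deMorgan₂ x y))))
      (B.trans (f-¬ _) (B.trans (B.¬-cong (B.trans (f-∧ _ _) (B.∧-cong (f-¬ x) (f-¬ y))))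
      (B.trans (B.¬-cong (B.sym (B≤.deMorgan₂ _ _))) (B≤.¬-involutive _))))
    reflects-≤ : ∀ x y → f x B.≈ f y → x A≤.≤ y
    reflects-≤ x y eq = A≤.disjoint∁⇒≤ (f-kernel _ (B.trans (f-∧ _ _) (B.trans (B.∧-congˡ (f-¬ _))
      (B.trans (B.∧-congʳ eq) (B.∧-complementʳ _)))))

  -- The image of f is regular exactly when every nonzero b has such a pseudo-projection a.
  Reductions : Embedding A B → Set ℓ
  Reductions f = ∀ b → b B.≉ B.⊥ →
    ∃[ a ] (a A.≉ A.⊥ × (∀ x → Embedding.to f x B.∧ b B.≈ B.⊥ → x A.∧ a A.≈ A.⊥))

  module EmbeddingKernel (f : Embedding A B) where
    open Embedding f
    kernel : ∀ {x} → to x B.≈ B.⊥ → x A.≈ A.⊥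
    kernel eq = injective (B.trans eq (B.sym ⊥-homo))

module _ {ℓ} {A B C : BooleanAlgebra ℓ ℓ} where
  private
    module B = BooleanAlgebra B
    module C = BooleanAlgebra C

  infixr 9 _∘ₑ_
  _∘ₑ_ : Embedding B C → Embedding A B → Embedding A C
  g ∘ₑ f = mkEmbedding (g.to ∘ f.to) (g.⟦⟧-cong ∘ f.⟦⟧-cong)
      (λ x y → C.trans (g.⟦⟧-cong (f.∧-homo x y)) (g.∧-homo _ _))
      (λ x → C.trans (g.⟦⟧-cong (f.¬-homo x)) (g.¬-homo _))
      (λ x → EmbeddingKernel.kernel f ∘ EmbeddingKernel.kernel g)
    where
    module f = Embedding f
    module g = Embedding g

  ∘-reductions : ∀ (g : Embedding B C) (f : Embedding A B) →
    Reductions g → Reductions f → Reductions (g ∘ₑ f)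
  ∘-reductions g f red-g red-f c c≉⊥ =
    let b , b≉⊥ , b-red = red-g c c≉⊥
        a , a≉⊥ , a-red = red-f b b≉⊥
    in a , a≉⊥ , λ x → a-red x ∘ b-red _

module _ {ℓ} {B : BooleanAlgebra ℓ ℓ} (V : Subalgebra B) where
  open BooleanAlgebra B using (refl)

  inclusion : Embedding (Subalgebra.algebra V) B
  inclusion = mkEmbedding proj₁ (λ eq → eq) (λ _ _ → refl) (λ _ → refl) (λ _ eq → eq)

  restrict : Subalgebra B → Subalgebra (Subalgebra.algebra V)
  restrict W = record
    { member   = W.member ∘ proj₁
    ; respects = W.respects
    ; ∨-closed = W.∨-closed
    ; ∧-closed = W.∧-closed
    ; ¬-closed = W.¬-closed
    ; ⊤-closed = W.⊤-closed
    ; ⊥-closed = W.⊥-closed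
    }
    where module W = Subalgebra W

  corestrict : ∀ {A : BooleanAlgebra ℓ ℓ} (f : Embedding A B) →
    (∀ x → Embedding.to f x ∈ Subalgebra.member V) → Embedding A (Subalgebra.algebra V)
  corestrict f f∈V = mkEmbedding (λ x → f.to x , f∈V x) f.⟦⟧-cong f.∧-homo f.¬-homo
      (λ _ → EmbeddingKernel.kernel f)
    where module f = Embedding f

-- Regular subalgebras through reductions

module Regularity (em : ∀ {a} → ExcludedMiddle a) {ℓ} (B : BooleanAlgebra ℓ ℓ) where
  open BooleanAlgebra B renaming (¬_ to ∁_)
  open BooleanOrder B
  open Subalgebra using (member)

  -- Equivalently, every nonzero element of V below v meets w.
  HasReductions : Subalgebra B → Subalgebra B → Set ℓ
  HasReductions V W = ∀ {w} → w ∈ member W → w ≉ ⊥ →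
    ∃[ v ] (v ∈ member V × v ≉ ⊥ × (∀ {x} → x ∈ member V → x ∧ w ≈ ⊥ → x ∧ v ≈ ⊥))

  insert-antichain : ∀ {V S v} → IsAntichain B V S → v ∈ member V → v ≉ ⊥ →
    (∀ {s} → s ∈ S → s ∧ v ≈ ⊥) → IsAntichain B V (S ∪ (_≈ v))
  insert-antichain {V} {S} {v} S-anti v∈V v≉⊥ S⊥v = record
    { contained = [ S.contained , (λ x≈v → Subalgebra.respects V (sym x≈v) v∈V) ]′
    ; respects  = λ { x≈y (inj₁ x∈S) → inj₁ (S.respects x≈y x∈S)
                    ; x≈y (inj₂ x≈v) → inj₂ (trans (sym x≈y) x≈v) }
    ; nonzero   = λ { (inj₁ x∈S) → S.nonzero x∈S
                    ; (inj₂ x≈v) x≈⊥ → v≉⊥ (trans (sym x≈v) x≈⊥) }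
    ; disjoint  = λ { (inj₁ x∈S) (inj₁ y∈S) x≉y → S.disjoint x∈S y∈S x≉y
                    ; (inj₁ x∈S) (inj₂ y≈v) _   → trans (∧-congˡ y≈v) (S⊥v x∈S)
                    ; (inj₂ x≈v) (inj₁ y∈S) _   → trans (∧-comm _ _) (trans (∧-congˡ x≈v) (S⊥v y∈S))
                    ; (inj₂ x≈v) (inj₂ y≈v) x≉y → contradiction (trans x≈v (sym y≈v)) x≉y }
    }
    where module S = IsAntichain S-anti

  -- An element t of T outside S is disjoint from all of S, hence so is its reduction v. Maximality
  -- in V then puts v into S and makes it disjoint from itself.
  hasReductions⇒⊑ : ∀ {V W} → member V ⊆ member W → HasReductions V W → _⊑_ B V W
  hasReductions⇒⊑ {V} {W} V⊆W red = V⊆W , λ S (S-anti , S-max) →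
    record { IsAntichain S-anti hiding (contained) ; contained = V⊆W ∘ IsAntichain.contained S-anti } ,
    λ T T-anti S⊆T {t} t∈T → decidable-stable em λ t∉S →
      let module S = IsAntichain S-anti
          module T = IsAntichain T-anti
          v , v∈V , v≉⊥ , v-red = red (T.contained t∈T) (T.nonzero t∈T)
          S⊥v = λ {s} (s∈S : s ∈ S) → v-red (S.contained s∈S)
                  (T.disjoint (S⊆T s∈S) t∈T (λ s≈t → t∉S (S.respects s≈t s∈S)))
          v∈S = S-max _ (insert-antichain {V} S-anti v∈V v≉⊥ S⊥v) inj₁ (inj₂ refl)
      in v≉⊥ (trans (sym (∧-idem v)) (S⊥v v∈S))

module _ {ℓ} (Λ : WellOrder ℓ) where
  open WellOrder Λ

  module Rank {a e} {S : Setoid a e} (S-small : Small Λ S) where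
    private module S = Setoid S
    bound : Carrier
    bound = proj₁ S-small
    code : S.Carrier → Segment bound
    code = Injection.to (proj₂ S-small)
    rank : S.Carrier → Carrier
    rank = proj₁ ∘ code
    rank-cong : ∀ {x y} → x S.≈ y → rank x ≡ rank y
    rank-cong eq = ≡.cong proj₁ (Injection.cong (proj₂ S-small) eq)
    rank-injective : ∀ {x y} → rank x ≡ rank y → x S.≈ y
    rank-injective {x} {y} eq =
      Injection.injective (proj₂ S-small) (Σ-≡,≡→≡ (eq , <-irrelevant _ _))
    rank<bound : ∀ x → rank x < bound
    rank<bound = proj₂ ∘ code

module SmallRegularity (em : ∀ {a} → ExcludedMiddle a) {ℓ} (Λ : WellOrder ℓ) (B : BooleanAlgebra ℓ ℓ) where
  open BooleanAlgebra B renaming (¬_ to ∁_)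
  open BooleanOrder B
  open Subalgebra using (member)
  open Regularity em B public
  open WellOrder Λ using (_<_; <-wellFounded; isStrictTotalOrder)
  open IsStrictTotalOrder isStrictTotalOrder using (compare)

  -- Smallness well-orders V through `rank`, so a maximal antichain of elements of D arises by
  -- recursion, without Zorn's lemma: an element is picked if it is disjoint from everything picked
  -- before it.
  module GreedyAntichain (V : Subalgebra B) (V-small : Small Λ (BooleanAlgebra.setoid (Subalgebra.algebra V)))
    (D : Pred Carrier ℓ) (D-respects : ∀ {x y} → x ≈ y → D x → D y) (D⊆V : D ⊆ member V)
    (D-nonzero : ∀ {x} → D x → x ≉ ⊥) where
    open Rank Λ V-small

    Picked : ∀ (z : Σ Carrier (member V)) → Acc _<_ (rank z) → Set ℓ
    Picked z (acc rs) = D (proj₁ z) × (∀ y (y<z : rank y < rank z) → Picked y (rs y<z) → proj₁ y ∧ proj₁ z ≈ ⊥)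

    Picked-respects : ∀ z z′ a a′ → proj₁ z ≈ proj₁ z′ → Picked z a → Picked z′ a′
    Picked-respects z z′ (acc rs) (acc rs′) eq (z∈D , earlier) = D-respects eq z∈D , λ y y<z′ y∈ →
      let y<z = ≡.subst (rank y <_) (rank-cong {z′} {z} (sym eq)) y<z′
      in trans (∧-congˡ (sym eq)) (earlier y y<z (Picked-respects y y (rs′ y<z′) (rs y<z) refl y∈))

    S : Pred Carrier ℓ
    S x = ∃[ x∈V ] Picked (x , x∈V) (<-wellFounded _)

    S⊆D : S ⊆ D
    S⊆D (x∈V , p) = picked⊆D (<-wellFounded _) p
      where
      picked⊆D : ∀ {z} a → Picked z a → D (proj₁ z)
      picked⊆D (acc _) = proj₁

    private
      disjoint-later : ∀ {y z} a → rank y < rank z → Picked z a → Picked y (<-wellFounded _) → proj₁ y ∧ proj₁ z ≈ ⊥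
      disjoint-later {y} (acc rs) y<z (_ , earlier) p = earlier y y<z (Picked-respects y y _ (rs y<z) refl p)

    S-antichain : IsAntichain B V S
    S-antichain = record
      { contained = proj₁
      ; respects  = λ { x≈y (x∈V , p) → Subalgebra.respects V x≈y x∈V , Picked-respects _ _ _ _ x≈y p }
      ; nonzero   = λ x∈S → D-nonzero (S⊆D x∈S)
      ; disjoint  = disjoint
      }
      where
      disjoint : ∀ {x y} → x ∈ S → y ∈ S → x ≉ y → x ∧ y ≈ ⊥
      disjoint {x} {y} (x∈V , p) (y∈V , q) x≉y with compare (rank (x , x∈V)) (rank (y , y∈V))
      ... | tri< x<y _ _ = disjoint-later (<-wellFounded _) x<y q p
      ... | tri≈ _ x≡y _ = contradiction (rank-injective x≡y) x≉y
      ... | tri> _ _ y<x = trans (∧-comm _ _) (disjoint-later (<-wellFounded _) y<x p q)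

    -- This is maximality: an element of D disjoint from all of S would itself have been picked.
    meets-S : ∀ {x} → D x → ∃[ s ] (s ∈ S × s ∧ x ≉ ⊥)
    meets-S {x} x∈D = decidable-stable em λ none →
      let x∈V = D⊆V x∈D
          x∈S = x∈V , picked (x , x∈V) (<-wellFounded _) x∈D none
      in none (x , x∈S , λ eq → D-nonzero x∈D (trans (sym (∧-idem x)) eq))
      where
      picked : ∀ z a → D (proj₁ z) → ¬ (∃[ s ] (s ∈ S × s ∧ proj₁ z ≉ ⊥)) → Picked z a
      picked z (acc rs) z∈D none = z∈D , λ y y<z p → decidable-stable em λ y∧z≉⊥ →
        none (proj₁ y , (proj₂ y , Picked-respects y y _ _ refl p) , y∧z≉⊥)

  -- If w had no reduction, a maximal antichain among the elements of V disjoint from w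
  -- would be maximal in V but not in W.
  ⊑⇒hasReductions : ∀ {V W} → Small Λ (BooleanAlgebra.setoid (Subalgebra.algebra V)) →
    _⊑_ B V W → HasReductions V W
  ⊑⇒hasReductions {V} {W} V-small (V⊆W , preserves) {w} w∈W w≉⊥ = decidable-stable em λ none →
    let dense : ∀ {v} → v ∈ member V → v ≉ ⊥ → ∃[ x ] (x ∈ member V × x ∧ w ≈ ⊥ × x ∧ v ≉ ⊥)
        dense {v} v∈V v≉⊥ = decidable-stable em λ no-x →
          none (v , v∈V , v≉⊥ , λ {x} x∈V x⊥w → decidable-stable em λ x∧v≉⊥ → no-x (x , x∈V , x⊥w , x∧v≉⊥))
        maximal : IsMaximalAntichain B V S
        maximal = S-antichain , λ T T-anti S⊆T {t} t∈T →
          let module T = IsAntichain T-anti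
              t∈V = T.contained t∈T
              x , x∈V , x⊥w , x∧t≉⊥ = dense t∈V (T.nonzero t∈T)
              s , s∈S , s∧x∧t≉⊥ = meets-S (Subalgebra.∧-closed V x∈V t∈V
                , disjoint-≤ (x∧y≤x x t) ≤-refl x⊥w , x∧t≉⊥)
              s≈t = decidable-stable em λ s≉t → s∧x∧t≉⊥
                (disjoint-≤ ≤-refl (x∧y≤y x t) (T.disjoint (S⊆T s∈S) t∈T s≉t))
          in IsAntichain.respects S-antichain s≈t s∈S
        S-anti , S-max = preserves S maximal
        w∈S = S-max _ (insert-antichain {W} S-anti w∈W w≉⊥ (λ s∈S → proj₁ (proj₂ (S⊆D s∈S)))) inj₁ (inj₂ refl)
    in w≉⊥ (trans (sym (∧-idem w)) (proj₁ (proj₂ (S⊆D w∈S))))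
    where
    D : Pred Carrier ℓ
    D x = x ∈ member V × x ∧ w ≈ ⊥ × x ≉ ⊥
    D-respects : ∀ {x y} → x ≈ y → D x → D y
    D-respects x≈y (x∈V , x⊥w , x≉⊥) =
      Subalgebra.respects V x≈y x∈V , trans (∧-congʳ (sym x≈y)) x⊥w , λ y≈⊥ → x≉⊥ (trans x≈y y≈⊥)
    D-nonzero : ∀ {x} → D x → x ≉ ⊥
    D-nonzero (_ , _ , x≉⊥) = x≉⊥
    open GreedyAntichain V V-small D D-respects proj₁ D-nonzero

  inclusion-reductions : ∀ V → Small Λ (BooleanAlgebra.setoid (Subalgebra.algebra V)) → IsRegular B V →
    Reductions (inclusion V)
  inclusion-reductions V V-small V-regular b b≉⊥ =
    let v , v∈V , v≉⊥ , v-red = ⊑⇒hasReductions {V} {whole B} V-small V-regular {b} tt b≉⊥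
    in (v , v∈V) , v≉⊥ , λ (x , x∈V) → v-red x∈V

module RegularEmbeddings (em : ∀ {a} → ExcludedMiddle a) {ℓ} {A B : BooleanAlgebra ℓ ℓ} where
  private
    module A = BooleanAlgebra A
    module B = BooleanAlgebra B

  hasReductions⇒reductions : (f : Embedding A B) →
    Regularity.HasReductions em B (Embedding.image f) (whole B) → Reductions f
  hasReductions⇒reductions f red b b≉⊥ =
    let v , (a , fa≈v) , v≉⊥ , v-red = red {b} tt b≉⊥
    in a , (λ a≈⊥ → v≉⊥ (B.trans (B.sym fa≈v) (B.trans (f.⟦⟧-cong a≈⊥) f.⊥-homo)))
     , λ x fx⊥b → EmbeddingKernel.kernel f (B.trans (f.∧-homo x a)
         (B.trans (B.∧-congˡ fa≈v) (v-red (x , B.refl) fx⊥b)))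
    where module f = Embedding f

  reductions⇒hasReductions : (f : Embedding A B) → Reductions f →
    ∀ {W} → Regularity.HasReductions em B (Embedding.image f) W
  reductions⇒hasReductions f red {_} {b} _ b≉⊥ =
    let a , a≉⊥ , a-red = red b b≉⊥
    in f.to a , (a , B.refl) , (λ eq → a≉⊥ (EmbeddingKernel.kernel f eq))
     , λ { (x , fx≈y) y⊥b → B.trans (B.∧-congʳ (B.sym fx≈y)) (B.trans (B.sym (f.∧-homo x a))
         (B.trans (f.⟦⟧-cong (a-red x (B.trans (B.∧-congʳ fx≈y) y⊥b))) f.⊥-homo)) }
    where module f = Embedding f

  mkRegularEmbedding : (f : Embedding A B) → Reductions f → RegularEmbedding A B
  mkRegularEmbedding f red = record
    { embedding = f
    ; isRegular = Regularity.hasReductions⇒⊑ em B {Embedding.image f} {whole B} _ (reductions⇒hasReductions f red {whole B})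
    }

  module _ (Λ : WellOrder ℓ) where

    image-small : (f : Embedding A B) → Small Λ A.setoid → Small Λ (BooleanAlgebra.setoid (Subalgebra.algebra (Embedding.image f)))
    image-small f (α , i) = α , record
      { to        = λ (_ , x , _) → Injection.to i x
      ; cong      = λ { {_ , x , p} {_ , y , q} eq → Injection.cong i
                        (f.injective (B.trans p (B.trans eq (B.sym q)))) }
      ; injective = λ { {_ , x , p} {_ , y , q} eq → B.trans (B.sym p)
                        (B.trans (f.⟦⟧-cong (Injection.injective i eq)) q) }
      }
      where module f = Embedding f

    -- Converse of `mkRegularEmbedding`. Smallness of A passes to the image, where the greedy
    -- antichain is built.
    reductions : Small Λ A.setoid → (f : RegularEmbedding A B) → Reductions (RegularEmbedding.embedding f)
    reductions A-small f = hasReductions⇒reductions f.embedding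
      (SmallRegularity.⊑⇒hasReductions em Λ B {Embedding.image f.embedding} {whole B} (image-small f.embedding A-small) f.isRegular)
      where module f = RegularEmbedding f

-- Cardinal arithmetic below a strongly inaccessible cardinal

T-extensional : ∀ {a b} → (T a → T b) → (T b → T a) → a ≡ b
T-extensional {true}  {true}  _ _ = ≡.refl
T-extensional {true}  {false} f _ = contradiction _ f
T-extensional {false} {true}  _ g = contradiction _ g
T-extensional {false} {false} _ _ = ≡.refl

module _ {a} {A : Set a} where
  nth : List A → ℕ → Maybe A
  nth []       _         = nothing
  nth (x ∷ xs) zero      = just x
  nth (x ∷ xs) (sucℕ n)  = nth xs n

  nth-injective : ∀ xs ys → (∀ n → nth xs n ≡ nth ys n) → xs ≡ ys
  nth-injective []       []       eq = ≡.refl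
  nth-injective []       (_ ∷ _)  eq with () ← eq 0
  nth-injective (_ ∷ _)  []       eq with () ← eq 0
  nth-injective (x ∷ xs) (y ∷ ys) eq =
    ≡.cong₂ _∷_ (just-injective (eq 0)) (nth-injective xs ys (eq ∘ sucℕ))

  just-extensional : ∀ {m m′ : Maybe A} → (∀ x → m ≡ just x → m′ ≡ just x) →
    (∀ x → m′ ≡ just x → m ≡ just x) → m ≡ m′
  just-extensional {just x}  f g = ≡.sym (f x ≡.refl)
  just-extensional {nothing} {just y}  f g = g y ≡.refl
  just-extensional {nothing} {nothing} f g = ≡.refl

module Cardinals (em : ∀ {a} → ExcludedMiddle a) {ℓ} (Λ : WellOrder ℓ) (inacc : IsStronglyInaccessible Λ) where
  open WellOrder Λ public using (_<_; Segment; <-wellFounded; <-irrelevant) renaming (Carrier to Ord)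
  open IsStrictTotalOrder (WellOrder.isStrictTotalOrder Λ) public
    using (compare) renaming (trans to <-trans; irrefl to <-irrefl; asym to <-asym)
  open IsStronglyInaccessible inacc

  least : ∀ {l} (P : Pred Ord l) → ∃ P → ∃[ α ] (P α × (∀ β → P β → ¬ β < α))
  least P (α , p) = go α (<-wellFounded α) p
    where
    go : ∀ α → Acc _<_ α → P α → ∃[ α ] (P α × (∀ β → P β → ¬ β < α))
    go α (acc rs) p with em {P = ∃[ β ] (P β × β < α)}
    ... | yes (β , q , β<α) = go β (rs β<α) q
    ... | no none = α , p , λ β q β<α → none (β , q , β<α)

  <-≮-trans : ∀ {α β γ} → α < β → ¬ γ < β → α < γ
  <-≮-trans {α} {β} {γ} α<β γ≮β with compare β γ
  ... | tri< β<γ _ _      = <-trans α<β β<γ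
  ... | tri≈ _ ≡.refl _   = α<β
  ... | tri> _ _ γ<β      = contradiction γ<β γ≮β

  ω-small : Small Λ (≡.setoid ℕ)
  ω-small = isUncountable

  above : ∀ α → ∃[ γ ] α < γ
  -- A constant function is bounded strictly; its domain is nonempty because it contains the code of
  -- 0.
  above α = let γ , h = isRegular (proj₁ ω-small) (λ _ → α)
            in γ , h (Injection.to (proj₂ ω-small) 0)

  above₂ : ∀ α β → ∃[ γ ] (α < γ × β < γ)
  above₂ α β with compare α β
  ... | tri< α<β _ _    = let γ , β<γ = above β in γ , <-trans α<β β<γ , β<γ
  ... | tri≈ _ ≡.refl _ = let γ , β<γ = above β in γ , β<γ , β<γ
  ... | tri> _ _ β<α    = let γ , α<γ = above α in γ , α<γ , <-trans β<α α<γ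

  segment-injective : ∀ {α} {ξ ζ : Segment α} → proj₁ ξ ≡ proj₁ ζ → ξ ≡ ζ
  segment-injective eq = Σ-≡,≡→≡ (eq , <-irrelevant _ _)

  small-↪ : ∀ {a e a′ e′} {S : Setoid a e} {S′ : Setoid a′ e′} → Injection S S′ → Small Λ S′ → Small Λ S
  small-↪ f (α , g) = α , injection f g

  -- Regularity of λ, applied to one representative per code. The bound moves from the
  -- representative to every equal element through `Q-resp`, so the witnesses themselves may depend
  -- on the representative.
  bounded : ∀ {a e q} {S : Setoid a e} → Small Λ S → (Q : Setoid.Carrier S → Ord → Set q) →
    (∀ {x y α} → Setoid._≈_ S x y → Q x α → Q y α) → (∀ {x α β} → α < β → Q x α → Q x β) →
    (∀ x → ∃[ α ] Q x α) → ∃[ β ] (∀ x → Q x β)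
  bounded {S = S} S-small Q Q-resp Q-mono h = γ , λ x → lemma x
    where
    open Rank Λ S-small
    g : ∀ ξ → Dec (∃[ x ] code x ≡ ξ) → Ord
    g ξ (yes (x , _)) = proj₁ (h x)
    g ξ (no _)        = bound
    γ = proj₁ (isRegular bound (λ ξ → g ξ em))
    lemma : ∀ x → Q x γ
    lemma x with em {P = ∃[ y ] code y ≡ code x} | proj₂ (isRegular bound (λ ξ → g ξ em)) (code x)
    ... | yes (y , eq) | hy<γ = Q-resp (rank-injective (≡.cong proj₁ eq)) (Q-mono hy<γ (proj₂ (h y)))
    ... | no none | _ = contradiction (x , ≡.refl) none

  private
    char : ∀ {a p} {X : Set a} → Pred X p → X → Bool
    char P x = ⌊ em {P = P x} ⌋

    char-cong : ∀ {a p q} {X : Set a} {P : Pred X p} {Q : Pred X q} x y → (P x → Q y) → (Q y → P x) → char P x ≡ char Q y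
    char-cong _ _ f g = T-extensional (fromWitness ∘ f ∘ toWitness) (fromWitness ∘ g ∘ toWitness)

    char-elim : ∀ {a p q} {X : Set a} {P : Pred X p} {Q : Pred X q} → (∀ x → char P x ≡ char Q x) → ∀ x → P x → Q x
    char-elim eq x p = toWitness (≡.subst T (eq x) (fromWitness p))

  small-power : ∀ {a} {X : Set a} → Small Λ (≡.setoid X) → Small Λ (X →-setoid Bool)
  small-power {X = X} X-small = small-↪ inj (isStrongLimit bound)
    where
    open Rank Λ X-small
    P : (X → Bool) → Pred (Segment bound) _
    P U ξ = ∃[ x ] (code x ≡ ξ × T (U x))
    code-injective : ∀ {x y} → code x ≡ code y → x ≡ y
    code-injective = rank-injective ∘ ≡.cong proj₁
    inj : Injection (X →-setoid Bool) (Segment bound →-setoid Bool)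
    inj = record
      { to        = λ U → char (P U)
      ; cong      = λ {U} {V} eq ξ → char-cong {P = P U} {Q = P V} ξ ξ
                      (λ (x , e , t) → x , e , ≡.subst T (eq x) t)
                      (λ (x , e , t) → x , e , ≡.subst T (≡.sym (eq x)) t)
      ; injective = λ {U} {V} eq x → T-extensional (transfer U V eq x) (transfer V U (≡.sym ∘ eq) x)
      }
      where
      transfer : ∀ U V → (∀ ξ → char (P U) ξ ≡ char (P V) ξ) → ∀ x → T (U x) → T (V x)
      transfer U V eq x t =
        let y , e , t′ = char-elim {P = P U} {Q = P V} eq (code x) (x , ≡.refl , t)
        in ≡.subst (T ∘ V) (code-injective e) t′

  -- X ⊎ Y embeds into the power set of a segment: x goes to a singleton and y to the
  -- complement of a singleton. They differ since the segment has at least three elements.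
  small-⊎ : ∀ {a b} {X : Set a} {Y : Set b} → Small Λ (≡.setoid X) → Small Λ (≡.setoid Y) → Small Λ (≡.setoid (X ⊎ Y))
  small-⊎ {X = X} {Y} X-small Y-small = small-↪ inj (isStrongLimit γ)
    where
    module X = Rank Λ X-small
    module Y = Rank Λ Y-small
    module N = Rank Λ ω-small
    γ′ = above₂ X.bound Y.bound
    γ″ = above₂ (proj₁ γ′) N.bound
    γ = proj₁ γ″
    x̂ : X → Segment γ
    x̂ x = X.rank x , <-trans (X.rank<bound x) (<-trans (proj₁ (proj₂ γ′)) (proj₁ (proj₂ γ″)))
    ŷ : Y → Segment γ
    ŷ y = Y.rank y , <-trans (Y.rank<bound y) (<-trans (proj₂ (proj₂ γ′)) (proj₁ (proj₂ γ″)))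
    n̂ : ℕ → Segment γ
    n̂ n = N.rank n , <-trans (N.rank<bound n) (proj₂ (proj₂ γ″))
    P : X ⊎ Y → Pred (Segment γ) ℓ
    P (inj₁ x) ξ = ξ ≡ x̂ x
    P (inj₂ y) ξ = ¬ (ξ ≡ ŷ y)
    n̂-injective : ∀ {m n} → n̂ m ≡ n̂ n → m ≡ n
    n̂-injective = N.rank-injective ∘ ≡.cong proj₁
    distinct : ∀ {ξ ζ : Segment γ} → ¬ (∀ n → ¬ (n̂ n ≡ ξ) → n̂ n ≡ ζ)
    distinct {ξ} h with em {P = n̂ 0 ≡ ξ} | em {P = n̂ 1 ≡ ξ}
    ... | no ≢0 | no ≢1 with () ← n̂-injective (≡.trans (h 0 ≢0) (≡.sym (h 1 ≢1)))
    ... | yes ≡0 | yes ≡1 with () ← n̂-injective (≡.trans ≡0 (≡.sym ≡1))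
    ... | yes ≡0 | no ≢1
      with () ← n̂-injective {1} {2} (≡.trans (h 1 ≢1) (≡.sym (h 2 λ ≡2 → contradiction (n̂-injective (≡.trans ≡2 (≡.sym ≡0))) λ ())))
    ... | no ≢0 | yes ≡1
      with () ← n̂-injective {0} {2} (≡.trans (h 0 ≢0) (≡.sym (h 2 λ ≡2 → contradiction (n̂-injective (≡.trans ≡2 (≡.sym ≡1))) λ ())))
    P-injective : ∀ u v → (∀ ξ → char (P u) ξ ≡ char (P v) ξ) → u ≡ v
    P-injective (inj₁ x) (inj₁ x′) eq = ≡.cong inj₁ (X.rank-injective (≡.cong proj₁
      (char-elim {P = P (inj₁ x)} {Q = P (inj₁ x′)} eq (x̂ x) ≡.refl)))
    P-injective (inj₂ y) (inj₂ y′) eq = ≡.cong inj₂ (Y.rank-injective (≡.cong proj₁ (≡.sym (decidable-stable em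
      λ ne → char-elim {P = P (inj₂ y)} {Q = P (inj₂ y′)} eq (ŷ y′) ne ≡.refl))))
    P-injective (inj₁ x) (inj₂ y) eq = contradiction
      (λ n ne → char-elim {P = P (inj₂ y)} {Q = P (inj₁ x)} (≡.sym ∘ eq) (n̂ n) ne) distinct
    P-injective (inj₂ y) (inj₁ x) eq = contradiction
      (λ n ne → char-elim {P = P (inj₂ y)} {Q = P (inj₁ x)} eq (n̂ n) ne) distinct
    inj : Injection (≡.setoid (X ⊎ Y)) (Segment γ →-setoid Bool)
    inj = record { to = char ∘ P ; cong = λ { ≡.refl _ → ≡.refl } ; injective = P-injective _ _ }

  -- A pair is coded by the subset of the disjoint sum consisting of its two components, so the
  -- strong limit property replaces the usual pairing of ordinals.
  small-× : ∀ {a b} {X : Set a} {Y : Set b} → Small Λ (≡.setoid X) → Small Λ (≡.setoid Y) → Small Λ (≡.setoid (X × Y))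
  small-× {X = X} {Y} X-small Y-small = small-↪ inj (small-power (small-⊎ X-small Y-small))
    where
    P : X × Y → Pred (X ⊎ Y) _
    P (x , y) u = u ≡ inj₁ x ⊎ u ≡ inj₂ y
    P-injective : ∀ u v → (∀ ξ → char (P u) ξ ≡ char (P v) ξ) → u ≡ v
    P-injective (x , y) (x′ , y′) eq
      with char-elim {P = P (x , y)} {Q = P (x′ , y′)} eq (inj₁ x) (inj₁ ≡.refl)
         | char-elim {P = P (x , y)} {Q = P (x′ , y′)} eq (inj₂ y) (inj₂ ≡.refl)
    ... | inj₁ ≡.refl | inj₂ ≡.refl = ≡.refl
    inj : Injection (≡.setoid (X × Y)) ((X ⊎ Y) →-setoid Bool)
    inj = record { to = char ∘ P ; cong = λ { ≡.refl _ → ≡.refl } ; injective = P-injective _ _ }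

  -- A list is coded by its graph, a finite partial function from ℕ to X.
  small-List : ∀ {a} {X : Set a} → Small Λ (≡.setoid X) → Small Λ (≡.setoid (List X))
  small-List {X = X} X-small = small-↪ inj (small-power (small-× ω-small X-small))
    where
    P : List X → Pred (ℕ × X) _
    P xs (n , x) = nth xs n ≡ just x
    inj : Injection (≡.setoid (List X)) ((ℕ × X) →-setoid Bool)
    inj = record
      { to        = char ∘ P
      ; cong      = λ { ≡.refl _ → ≡.refl }
      ; injective = λ {xs} {ys} eq → nth-injective xs ys λ n → just-extensional
          (λ x → char-elim {P = P xs} {Q = P ys} eq (n , x))
          (λ x → char-elim {P = P ys} {Q = P xs} (≡.sym ∘ eq) (n , x))
      }

-- Forcing with finite lists

module ListForcing (em : ∀ {a} → ExcludedMiddle a) {ℓ} (E : Set ℓ) where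

  -- Later entries of a condition are consed onto the front.
  infix 4 _≼_
  _≼_ : List E → List E → Set ℓ
  q ≼ p = ∃[ t ] t ++ p ≡ q

  ≼-refl : ∀ {p} → p ≼ p
  ≼-refl = [] , ≡.refl

  ≼-trans : ∀ {p q r} → p ≼ q → q ≼ r → p ≼ r
  ≼-trans (s , ≡.refl) (t , ≡.refl) = s ++ t , ++-assoc s t _

  open RegularOpenSets em _≼_ ≼-refl ≼-trans public

  Stable : ∀ {l} → Rel (List E) l → Set (ℓ ⊔ l)
  Stable _~_ = ∀ t {p q} → p ~ q → (t ++ p) ~ (t ++ q)

  -- An extension of q by t is mirrored by the extension of p by the same t; the further extension
  -- found there is carried back by prepending it to the q side as well.
  regularize-invariant : ∀ {r l} {_~_ : Rel (List E) r} {O : Pred (List E) l} → Stable _~_ →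
    (∀ {p q} → p ~ q → O p → O q) → ∀ {p q} → p ~ q → regularize O ∋ p → regularize O ∋ q
  regularize-invariant {O = O} stable O-resp {p} {q} p~q d = regularize⁺ {O = O} λ where
    _ (t , ≡.refl) →
      let r , (u , eq) , o = regularize⁻ {O = O} d (t ++ p) (t , ≡.refl)
      in u ++ (t ++ q) , (u , ≡.refl) , O-resp (stable u (stable t p~q)) (≡.subst O (≡.sym eq) o)

-- Absorption of a regular extension along a generic path

module GenericPaths (em : ∀ {a} → ExcludedMiddle a) {ℓ} (E : Set ℓ) where
  open ListForcing em E

  -- For a regular extension g : B → C and an embedding f of B into the regular open
  -- algebra of List E, a condition carries a list of elements of C, which is read as a
  -- descending path in the quotient of C by the generic filter of B. The path meets every
  -- dense set, so it induces an embedding of C.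
  module Absorption {B C : BooleanAlgebra ℓ ℓ}
    (g : Embedding B C) (g-reductions : Reductions g)
    (f : Embedding B regularOpenAlgebra)
    -- Regularity of f tested on single conditions: b is a reduction of the cone below q.
    (f-reductions : ∀ q → ∃[ b ] (¬ BooleanAlgebra._≈_ B b (BooleanAlgebra.⊥ B) ×
       (∀ x → (∀ {r} → r ≼ q → ¬ (Embedding.to f x ∋ r)) →
         BooleanAlgebra._≈_ B (BooleanAlgebra._∧_ B x b) (BooleanAlgebra.⊥ B))))
    (path : List E → List (BooleanAlgebra.Carrier C))
    (path-++ : ∀ t q → path (t ++ q) ≡ path t ++ path q)
    (path-[] : path [] ≡ [])
    (enter : ∀ c → ∃[ e ] ∃[ c′ ] (BooleanAlgebra._≈_ C c′ c × path (e ∷ []) ≡ c′ ∷ []))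
    -- Whatever an extension of q forces about B can also be forced by an extension that leaves the
    -- path where it is.
    (idle : ∀ b t q → Embedding.to f b ∋ (t ++ q) → ∃[ u ] (path u ≡ [] × Embedding.to f b ∋ (u ++ q)))
    where

    private
      module B = BooleanAlgebra B
      module C = BooleanAlgebra C
      module B≤ = BooleanOrder B
      module C≤ = BooleanOrder C
      module f = Embedding f
      module g = Embedding g
    open C≤ using (_≤_)

    f-∧ : ∀ {b b′ q} → f.to b ∋ q → f.to b′ ∋ q → f.to (b B.∧ b′) ∋ q
    f-∧ {b} {b′} {q} p p′ = proj₂ (f.∧-homo b b′) q (∧ᵣ-intro (f.to b) (f.to b′) p p′)

    f-mono : ∀ {b b′ q} → b B≤.≤ b′ → f.to b ∋ q → f.to b′ ∋ q
    f-mono {b} {b′} {q} b≤b′ p = proj₂ (∧ᵣ-elim (f.to b) (f.to b′)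
      (proj₁ (f.∧-homo b b′) q (proj₁ (f.⟦⟧-cong b≤b′) q p)))

    f-⊥ : ∀ {q} → ¬ f.to B.⊥ ∋ q
    f-⊥ {q} p = ∌⊥ᵣ (proj₁ f.⊥-homo q p)

    f-∁⁺ : ∀ {b q} → (∁ᵣ f.to b) ∋ q → f.to (B.¬ b) ∋ q
    f-∁⁺ {b} {q} = proj₂ (f.¬-homo b) q

    f-∁⁻ : ∀ {b q} → f.to (B.¬ b) ∋ q → ¬ (f.to b ∋ q)
    f-∁⁻ {b} {q} p = ∁ᵣ-elim (f.to b) (proj₁ (f.¬-homo b) q p)

    path-idle : ∀ {u} q → path u ≡ [] → path (u ++ q) ≡ path q
    path-idle {u} q eq = ≡.trans (path-++ u q) (≡.cong (_++ path q) eq)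

    -- q forces that c is compatible with the generic filter of B.
    infix 4 _⊩_
    _⊩_ : List E → C.Carrier → Set ℓ
    q ⊩ c = ∀ b → c ≤ g.to b → f.to b ∋ q

    Refutes : List E → C.Carrier → Set ℓ
    Refutes q c = ∃[ b ] (c ≤ g.to b × f.to (B.¬ b) ∋ q)

    ⊩-≼ : ∀ {q r c} → r ≼ q → q ⊩ c → r ⊩ c
    ⊩-≼ r≼q q⊩c b c≤gb = open- (f.to b) r≼q (q⊩c b c≤gb)

    ⊩-mono : ∀ {q c d} → c ≤ d → q ⊩ c → q ⊩ d
    ⊩-mono c≤d q⊩c b d≤gb = q⊩c b (C≤.≤-trans c≤d d≤gb)

    ⊩-¬Refutes : ∀ {q c} → q ⊩ c → ¬ Refutes q c
    ⊩-¬Refutes q⊩c (b , c≤gb , p) = f-∁⁻ p (q⊩c b c≤gb)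

    ⊩-nonzero : ∀ {q c} → q ⊩ c → c C.≉ C.⊥
    ⊩-nonzero q⊩c c≈⊥ = f-⊥ (q⊩c B.⊥ (C≤.≤-trans (C≤.≤-reflexive c≈⊥) (C≤.⊥-least _)))

    ⊩⊤ : ∀ {q} → q ⊩ C.⊤
    ⊩⊤ {q} b ⊤≤gb = f-mono {B.⊤} (B≤.≤-reflexive (g.injective
      (C.trans g.⊤-homo (C≤.antisym ⊤≤gb (C≤.⊤-greatest _))))) (proj₂ f.⊤-homo q ∋⊤ᵣ)

    ⊩-∧ : ∀ {q c b} → q ⊩ c → f.to b ∋ q → q ⊩ c C.∧ g.to b
    ⊩-∧ {b = b} q⊩c p b′ le = f-mono B≤.modus-ponens (f-∧ (q⊩c ((B.¬ b) B.∨ b′)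
      (C≤.≤-trans (C≤.curry-∧ le) (C≤.≤-reflexive (C.trans (C.∨-congʳ (C.sym (g.¬-homo b))) (C.sym (g.∨-homo _ _))))))
      p)

    -- If q does not force c, some b with c ≤ g b is not forced, so an extension lies in the
    -- complement of f b; `idle` replaces it by one that does not touch the path.
    decides : ∀ q c → q ⊩ c ⊎ ∃[ u ] (path u ≡ [] × Refutes (u ++ q) c)
    decides q c with em {P = q ⊩ c}
    ... | yes q⊩c = inj₁ q⊩c
    ... | no q⊮c = decidable-stable em λ neither → q⊮c λ b c≤gb → decidable-stable em λ q∉fb →
      let r , (t , t++q≡r) , r∈ = ∌⇒∁ᵣ-below (f.to b) q∉fb
          u , idle-u , u∈ = idle (B.¬ b) t q (f-∁⁺ (≡.subst ((∁ᵣ f.to b) ∋_) (≡.sym t++q≡r) r∈))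
      in neither (inj₂ (u , idle-u , b , c≤gb , u∈))

    -- The walk starts at ⊤ and reads s from its tail: a proposed c is taken if it descends and is
    -- compatible with the generic filter, and ignored otherwise. It is a relation and not a
    -- function because q may leave the compatibility of c undecided.
    data Endpoint (q : List E) : List C.Carrier → C.Carrier → Set ℓ where
      start  : Endpoint q [] C.⊤
      accept : ∀ {s e c} → Endpoint q s e → c ≤ e → q ⊩ c → Endpoint q (c ∷ s) c
      reject : ∀ {s e c} → Endpoint q s e → ¬ c ≤ e ⊎ Refutes q c → Endpoint q (c ∷ s) e

    -- Acceptance and refutation are both positive statements about membership in values of f, so
    -- implications in one direction suffice.
    endpoint-transfer : ∀ {q r s e} → (∀ b → f.to b ∋ q → f.to b ∋ r) → Endpoint q s e → Endpoint r s e
    endpoint-transfer _   start              = start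
    endpoint-transfer q⇒r (accept v c≤e q⊩c) = accept (endpoint-transfer q⇒r v) c≤e (λ b → q⇒r b ∘ q⊩c b)
    endpoint-transfer q⇒r (reject v (inj₁ c≰e)) = reject (endpoint-transfer q⇒r v) (inj₁ c≰e)
    endpoint-transfer q⇒r (reject v (inj₂ (b , c≤gb , p))) =
      reject (endpoint-transfer q⇒r v) (inj₂ (b , c≤gb , q⇒r (B.¬ b) p))

    endpoint-≼ : ∀ {q r s e} → r ≼ q → Endpoint q s e → Endpoint r s e
    endpoint-≼ r≼q = endpoint-transfer λ b → open- (f.to b) r≼q

    endpoint-unique : ∀ {q s e e′} → Endpoint q s e → Endpoint q s e′ → e ≡ e′
    endpoint-unique start start = ≡.refl
    endpoint-unique (accept _ _ _) (accept _ _ _) = ≡.refl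
    endpoint-unique (reject v _) (reject v′ _) = endpoint-unique v v′
    endpoint-unique (accept v c≤e q⊩c) (reject v′ (inj₂ r)) = contradiction r (⊩-¬Refutes q⊩c)
    endpoint-unique (reject v′ (inj₂ r)) (accept v c≤e q⊩c) = contradiction r (⊩-¬Refutes q⊩c)
    endpoint-unique (accept v c≤e q⊩c) (reject v′ (inj₁ c≰e)) = contradiction (≡.subst (_ ≤_) (endpoint-unique v v′) c≤e) c≰e
    endpoint-unique (reject v′ (inj₁ c≰e)) (accept v c≤e q⊩c) = contradiction (≡.subst (_ ≤_) (endpoint-unique v v′) c≤e) c≰e

    endpoint-forced : ∀ {q s e} → Endpoint q s e → q ⊩ e
    endpoint-forced start            = ⊩⊤
    endpoint-forced (accept _ _ q⊩c) = q⊩c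
    endpoint-forced (reject v _)     = endpoint-forced v

    endpoint-++ : ∀ {q s e e′} t → Endpoint q s e → Endpoint q (t ++ s) e′ → e′ ≤ e
    endpoint-++ [] v v′ = C≤.≤-reflexive (C.reflexive (endpoint-unique v′ v))
    endpoint-++ (c ∷ t) v (accept v′ c≤e _) = C≤.≤-trans c≤e (endpoint-++ t v v′)
    endpoint-++ (c ∷ t) v (reject v′ _)     = endpoint-++ t v v′

    -- Finitely many proposals have to be decided, and each decision is idle, so the list being read
    -- does not grow meanwhile.
    endpoint-exists : ∀ q s → ∃[ u ] ∃[ e ] (path u ≡ [] × Endpoint (u ++ q) s e)
    endpoint-exists q [] = [] , C.⊤ , path-[] , start
    endpoint-exists q (c ∷ s) =
      let u , e , idle-u , v = endpoint-exists q s
      in extend idle-u v em (decides (u ++ q) c)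
      where
      extend : ∀ {u e} → path u ≡ [] → Endpoint (u ++ q) s e → Dec (c ≤ e) →
        (u ++ q) ⊩ c ⊎ ∃[ u′ ] (path u′ ≡ [] × Refutes (u′ ++ (u ++ q)) c) →
        ∃[ u ] ∃[ e ] (path u ≡ [] × Endpoint (u ++ q) (c ∷ s) e)
      extend {u} {e} idle-u v (no c≰e)  _          = u , e , idle-u , reject v (inj₁ c≰e)
      extend {u} {e} idle-u v (yes c≤e) (inj₁ q⊩c) = u , c , idle-u , accept v c≤e q⊩c
      extend {u} {e} idle-u v (yes c≤e) (inj₂ (u′ , idle-u′ , r)) =
        u′ ++ u , e , ≡.trans (path-idle u idle-u′) idle-u ,
        ≡.subst (λ q → Endpoint q (c ∷ s) e) (≡.sym (++-assoc u′ u q)) (reject (endpoint-≼ (u′ , ≡.refl) v) (inj₂ r))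

    At : List E → C.Carrier → Set ℓ
    At q e = Endpoint q (path q) e

    at-idle : ∀ {q e u} → path u ≡ [] → At q e → At (u ++ q) e
    at-idle {q} idle-u v = ≡.subst (λ s → Endpoint _ s _) (≡.sym (path-idle q idle-u)) (endpoint-≼ (_ , ≡.refl) v)

    at-exists : ∀ q → ∃[ r ] (r ≼ q × ∃[ e ] At r e)
    at-exists q =
      let u , e , idle-u , v = endpoint-exists q (path q)
      in u ++ q , (u , ≡.refl) , e , ≡.subst (λ s → Endpoint (u ++ q) s e) (≡.sym (path-idle q idle-u)) v

    at-≼ : ∀ {q r e e′} → r ≼ q → At q e → At r e′ → e′ ≤ e
    at-≼ {q} (t , ≡.refl) v v′ = endpoint-++ (path t) (endpoint-≼ (t , ≡.refl) v)
      (≡.subst (λ s → Endpoint _ s _) (path-++ t q) v′)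

    at-nonzero : ∀ {q e} → At q e → e C.≉ C.⊥
    at-nonzero = ⊩-nonzero ∘ endpoint-forced

    -- The source of genericity: one more entry takes the walk to any compatible element below the
    -- current endpoint. The new endpoint equals c only up to ≈, since an entry determines an
    -- element only up to ≈.
    move-to : ∀ {q e c} → At q e → c ≤ e → q ⊩ c → ∃[ r ] (r ≼ q × ∃[ c′ ] (At r c′ × c′ C.≈ c))
    move-to {q} {e} {c} v c≤e q⊩c =
      let a , c′ , c′≈c , eq = enter c
          c′≤c = C≤.≤-reflexive c′≈c
          c≤c′ = C≤.≤-reflexive (C.sym c′≈c)
      in a ∷ q , (a ∷ [] , ≡.refl) , c′
       , ≡.subst (λ s → Endpoint (a ∷ q) s c′) (≡.sym (≡.trans (path-++ (a ∷ []) q) (≡.cong (_++ path q) eq)))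
           (accept (endpoint-≼ (a ∷ [] , ≡.refl) v) (C≤.≤-trans c′≤c c≤e) (⊩-≼ (a ∷ [] , ≡.refl) (⊩-mono c≤c′ q⊩c)))
       , c′≈c

    Below : C.Carrier → List E → Set ℓ
    Below c q = ∃[ e ] (At q e × e ≤ c)

    -- The Boolean value of the statement that the path eventually drops below c, that is, that c
    -- lies in the filter generated by the path.
    h : C.Carrier → RegularOpen
    h c = regularize (Below c)

    below⇒h : ∀ {c q} → Below c q → h c ∋ q
    below⇒h {c} (e , v , e≤c) = regularize⁺ {O = Below c} λ r r≼q →
      let s , s≼r , e′ , v′ = at-exists r
      in s , s≼r , e′ , v′ , C≤.≤-trans (at-≼ (≼-trans s≼r r≼q) v v′) e≤c

    h-mono : ∀ {c d q} → c ≤ d → h c ∋ q → h d ∋ q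
    h-mono {c} {d} {q} c≤d = regularize-least {O = Below c} (h d)
      (λ r (e , v , e≤c) → below⇒h (e , v , C≤.≤-trans e≤c c≤d)) q

    h-common : ∀ {c d q} → h c ∋ q → h d ∋ q → ∃[ r ] (r ≼ q × ∃[ e ] (At r e × e ≤ c × e ≤ d))
    h-common {c} {d} {q} p p′ =
      let r , r≼q , e , v , e≤c = regularize⁻ {O = Below c} p q ≼-refl
          s , s≼r , e′ , v′ , e′≤d = regularize⁻ {O = Below d} p′ r r≼q
      in s , ≼-trans s≼r r≼q , e′ , v′ , C≤.≤-trans (at-≼ s≼r v v′) e≤c , e′≤d

    h-∧ : ∀ c d → h (c C.∧ d) ≈ᵣ h c ∧ᵣ h d
    h-∧ c d = (λ q p → ∧ᵣ-intro (h c) (h d) (h-mono (C≤.x∧y≤x c d) p) (h-mono (C≤.x∧y≤y c d) p))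
            , (λ q p → let p₁ , p₂ = ∧ᵣ-elim (h c) (h d) p in
                regularize⁺ {O = Below (c C.∧ d)} λ r r≼q →
                  let s , s≼r , e , v , e≤c , e≤d = h-common {c} {d} (open- (h c) r≼q p₁) (open- (h d) r≼q p₂)
                  in s , s≼r , e , v , C≤.∧-greatest e≤c e≤d)

    h-disjoint : ∀ {c q} → h c ∋ q → ¬ (h (C.¬ c) ∋ q)
    h-disjoint {c} p p′ =
      let r , r≼q , e , v , e≤c , e≤∁c = h-common {c} {C.¬ c} p p′
      in at-nonzero v (C≤.∧-disjoint e≤c (C≤.≤∁⇒disjoint e≤∁c))

    -- If e ∧ c is not forced then some extension puts ∁ b into the generic filter for a b
    -- with e ∧ c ≤ g b, and this extension forces e ∧ ∁ c.
    h-dense : ∀ c q → ∃[ r ] (r ≼ q × (Below c r ⊎ Below (C.¬ c) r))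
    h-dense c q with at-exists q
    ... | r , r≼q , e , v with decides r (e C.∧ c)
    ... | inj₁ r⊩ =
      let s , s≼r , c′ , v′ , eq = move-to v (C≤.x∧y≤x e c) r⊩
      in s , ≼-trans s≼r r≼q , inj₁ (c′ , v′ , C≤.≤-trans (C≤.≤-reflexive eq) (C≤.x∧y≤y e c))
    ... | inj₂ (u , idle-u , b , e∧c≤gb , p) =
      let u++r⊩e = ⊩-≼ (u , ≡.refl) (endpoint-forced v)
          u++r⊩ = λ b′ le → f-mono (B≤.≤-trans (B≤.∧-greatest (B≤.x∧y≤y _ _) (B≤.x∧y≤x _ _))
                    (B≤.≤-trans (B≤.≤-reflexive (B.∧-congʳ (B.∨-congʳ (B.sym (B≤.¬-involutive b))))) B≤.modus-ponens))
                    (f-∧ p (u++r⊩e (b B.∨ b′) (C≤.≤-trans (C≤.∧-complement-split e∧c≤gb le)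
                      (C≤.≤-reflexive (C.sym (g.∨-homo b b′))))))
          s , s≼ , c′ , v′ , eq = move-to (at-idle idle-u v) (C≤.x∧y≤x e (C.¬ c)) u++r⊩
      in s , ≼-trans s≼ (≼-trans (u , ≡.refl) r≼q) , inj₂ (c′ , v′ , C≤.≤-trans (C≤.≤-reflexive eq) (C≤.x∧y≤y _ _))

    h-∁ : ∀ c → h (C.¬ c) ≈ᵣ ∁ᵣ h c
    h-∁ c = (λ q p → ∁ᵣ-intro (h c) λ r≼q p′ → h-disjoint {c} p′ (open- (h (C.¬ c)) r≼q p))
          , (λ q p → regularize⁺ {O = Below (C.¬ c)} λ r r≼q → below q p r r≼q)
      where
      below : ∀ q → (∁ᵣ h c) ∋ q → ∀ r → r ≼ q → ∃[ s ] (s ≼ r × Below (C.¬ c) s)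
      below q p r r≼q with h-dense c r
      ... | s , s≼r , inj₂ o = s , s≼r , o
      ... | s , s≼r , inj₁ o = contradiction (below⇒h o) (∁ᵣ-elim (h c) (open- (∁ᵣ h c) (≼-trans s≼r r≼q) p))

    h-extends-⊇ : ∀ {b q} → f.to b ∋ q → h (g.to b) ∋ q
    h-extends-⊇ {b} {q} p = regularize⁺ {O = Below (g.to b)} λ r r≼q →
      let s , s≼r , e , v = at-exists r
          t , t≼s , c′ , v′ , eq = move-to v (C≤.x∧y≤x e (g.to b))
            (⊩-∧ (endpoint-forced v) (open- (f.to b) (≼-trans s≼r r≼q) p))
      in t , ≼-trans t≼s s≼r , c′ , v′ , C≤.≤-trans (C≤.≤-reflexive eq) (C≤.x∧y≤y _ _)

    h-extends : ∀ b → h (g.to b) ≈ᵣ f.to b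
    h-extends b = (λ q p → decidable-stable em λ q∉fb →
        -- The inclusion already proved, applied to the complement of b, contradicts disjointness of
        -- the values at g b and its complement.
        let r , r≼q , r∈ = ∌⇒∁ᵣ-below (f.to b) q∉fb
        in h-disjoint {g.to b} (open- (h (g.to b)) r≼q p)
             (h-mono (C≤.≤-reflexive (g.¬-homo b)) (h-extends-⊇ (f-∁⁺ r∈))))
      , (λ q → h-extends-⊇)

    -- Regularity of g enters the forcing here. If c ≤ g b′, the complement of b′ is disjoint from
    -- c, hence from b, so b ≤ b′.
    reduction-forces : ∀ {b c q} → (∀ x → g.to x C.∧ c C.≈ C.⊥ → x B.∧ b B.≈ B.⊥) → f.to b ∋ q → q ⊩ c
    reduction-forces {b} {c} red p b′ c≤gb′ = f-mono (B≤.disjoint∁⇒≤ (B.trans (B.∧-comm _ _)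
      (red (B.¬ b′) (C.trans (C.∧-comm _ _) (C.trans (C.∧-congˡ (g.¬-homo b′)) (C≤.≤⇒disjoint∁ c≤gb′)))))) p

    h-kernel : ∀ c → h c ≈ᵣ ⊥ᵣ → c C.≈ C.⊥
    h-kernel c (hc⊆⊥ , _) = decidable-stable em λ c≉⊥ →
      let b , b≉⊥ , b-red = g-reductions c c≉⊥
          -- An idle condition has the empty path, whose endpoint ⊤ leaves room to move to c.
          u , idle-u , u∈ = point b≉⊥
          v = ≡.subst (λ s → Endpoint (u ++ []) s C.⊤) (≡.sym (≡.trans (path-idle [] idle-u) path-[])) start
          r , _ , c′ , v′ , eq = move-to v (C≤.⊤-greatest c) (reduction-forces b-red u∈)
      in ∌⊥ᵣ (hc⊆⊥ r (below⇒h (c′ , v′ , C≤.≤-reflexive eq)))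
      where
      point : ∀ {b} → b B.≉ B.⊥ → ∃[ u ] (path u ≡ [] × f.to b ∋ (u ++ []))
      point {b} b≉⊥ = decidable-stable em λ none → b≉⊥ (EmbeddingKernel.kernel f
        ((λ q p → contradiction (idle b q [] (≡.subst (f.to b ∋_) (≡.sym (++-identityʳ q)) p)) none) , (λ _ p → contradiction p ∌⊥ᵣ)))

    h-embedding : Embedding C regularOpenAlgebra
    h-embedding = mkEmbedding h
      (λ x≈y → (λ q → h-mono (C≤.≤-reflexive x≈y)) , (λ q → h-mono (C≤.≤-reflexive (C.sym x≈y))))
      h-∧ h-∁ h-kernel

    -- If q has endpoint e and b is a reduction of q in B, then e ∧ g b is a reduction of q in C.
    h-reductions : Reductions h-embedding
    h-reductions U U≉⊥ = let q , q∈U = point in reduce q∈U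
      where
      point : ∃[ q ] U ∋ q
      point = decidable-stable em λ none → U≉⊥ ((λ q p → contradiction (q , p) none) , (λ _ p → contradiction p ∌⊥ᵣ))
      reduce : ∀ {q₀} → U ∋ q₀ → ∃[ c ] (c C.≉ C.⊥ × (∀ x → h x ∧ᵣ U ≈ᵣ ⊥ᵣ → x C.∧ c C.≈ C.⊥))
      reduce {q₀} q₀∈U with at-exists q₀
      ... | q , q≼q₀ , e , v with f-reductions q
      ... | b , b≉⊥ , b-red = e C.∧ g.to b , nonzero , λ x hx⊥U → decidable-stable em λ x∧c≉⊥ → meets x hx⊥U x∧c≉⊥
        where
        force : ∀ {x} → x B.∧ b B.≉ B.⊥ → ∃[ u ] (path u ≡ [] × f.to x ∋ (u ++ q))
        force {x} x∧b≉⊥ = decidable-stable em λ none → x∧b≉⊥ (b-red x λ { (t , ≡.refl) p → none (idle x t q p) })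
        nonzero : e C.∧ g.to b C.≉ C.⊥
        nonzero eq =
          let u , _ , p = force (λ b∧b≈⊥ → b≉⊥ (B.trans (B.sym (B≤.∧-idem b)) b∧b≈⊥))
          in f-∁⁻ (⊩-≼ (u , ≡.refl) (endpoint-forced v) (B.¬ b)
               (C≤.≤-trans (C≤.disjoint⇒≤∁ eq) (C≤.≤-reflexive (C.sym (g.¬-homo b))))) p
        meets : ∀ x → h x ∧ᵣ U ≈ᵣ ⊥ᵣ → ¬ (x C.∧ (e C.∧ g.to b) C.≉ C.⊥)
        meets x (hx⊥U , _) d≉⊥ =
          let d = x C.∧ (e C.∧ g.to b)
              d≤x = C≤.x∧y≤x x (e C.∧ g.to b)
              d≤e = C≤.≤-trans (C≤.x∧y≤y x _) (C≤.x∧y≤x e _)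
              d≤gb = C≤.≤-trans (C≤.x∧y≤y x _) (C≤.x∧y≤y e _)
              -- As d lies below g b, its reduction a meets b. Hence f a can be entered below q by
              -- an idle extension, from which the walk moves to d.
              a , a≉⊥ , a-red = g-reductions d d≉⊥
              u , idle-u , u∈ = force {a} λ a∧b≈⊥ → a≉⊥ (B.trans (B.sym (B≤.∧-idem a)) (a-red a
                (C≤.disjoint-≤ C≤.≤-refl d≤gb (C.trans (C.sym (g.∧-homo a b)) (C.trans (g.⟦⟧-cong a∧b≈⊥) g.⊥-homo)))))
              r , r≼ , c′ , v′ , eq = move-to (at-idle idle-u v) d≤e (reduction-forces a-red u∈)
              hx∋r = below⇒h (c′ , v′ , C≤.≤-trans (C≤.≤-reflexive eq) d≤x)
          in ∌⊥ᵣ (hx⊥U r (∧ᵣ-intro (h x) U hx∋r (open- U (≼-trans r≼ (≼-trans (u , ≡.refl) q≼q₀)) q₀∈U)))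

    -- Bounds supports later: the value at c depends only on the path and on membership in values of
    -- f.
    h-invariant : ∀ {_~_ : Rel (List E) ℓ} → Stable _~_ → (∀ {p q} → p ~ q → path p ≡ path q) →
      (∀ b {p q} → p ~ q → f.to b ∋ p → f.to b ∋ q) → ∀ c {p q} → p ~ q → h c ∋ p → h c ∋ q
    h-invariant {_~_ = _~_} stable path-resp f-resp c = regularize-invariant {_~_ = _~_} {O = Below c} stable
      λ { {q = q} p~q (e , v , e≤c) → e
        , ≡.subst (λ s → Endpoint q s e) (path-resp p~q) (endpoint-transfer (λ b → f-resp b p~q) v) , e≤c }

    absorb : Σ[ ĥ ∈ Embedding C regularOpenAlgebra ]
      (∀ b → Embedding.to ĥ (g.to b) ≈ᵣ f.to b) × Reductions ĥ ×
      (∀ {_~_ : Rel (List E) ℓ} → Stable _~_ → (∀ {p q} → p ~ q → path p ≡ path q) →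
        (∀ b {p q} → p ~ q → f.to b ∋ p → f.to b ∋ q) →
        ∀ c {p q} → p ~ q → Embedding.to ĥ c ∋ p → Embedding.to ĥ c ∋ q)
    absorb = h-embedding , h-extends , h-reductions , λ {_~_} → h-invariant {_~_ = _~_}

-- The collapse algebra and its filtration

-- A condition assigns to each ordinal β a finite list of ordinals below β, as in the finite
-- support product of the posets collapsing β to ω; entries for different ordinals are interleaved.
module CollapseAlgebra (em : ∀ {a} → ExcludedMiddle a) {ℓ} (Λ : WellOrder ℓ) (inacc : IsStronglyInaccessible Λ) where
  open Cardinals em Λ inacc
  open IsStrictTotalOrder (WellOrder.isStrictTotalOrder Λ) using (_≟_)

  Entry : Set ℓ
  Entry = Σ Ord Segment

  key : Entry → Ord
  key = proj₁

  open ListForcing em Entry public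

  coordinate : Ord → List Entry → List Entry
  coordinate β = filter (λ e → key e ≟ β)

  keep : ∀ {p} → Pred Ord p → List Entry → List Entry
  keep D = filter (λ e → em {P = D (key e)})

  coordinate-++ : ∀ β p q → coordinate β (p ++ q) ≡ coordinate β p ++ coordinate β q
  coordinate-++ β = filter-++ (λ e → key e ≟ β)

  coordinate-keep : ∀ {l} {D : Pred Ord l} {β} → D β → ∀ p → coordinate β (keep D p) ≡ coordinate β p
  coordinate-keep d [] = ≡.refl
  coordinate-keep {D = D} {β} d (e ∷ p) with em {P = D (key e)}
  ... | no ¬d = ≡.trans (coordinate-keep d p) (≡.sym (filter-reject (λ e → key e ≟ β) λ { ≡.refl → ¬d d }))
  ... | yes _ with key e ≟ β
  ... | yes _ = ≡.cong (e ∷_) (coordinate-keep d p)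
  ... | no _  = coordinate-keep d p

  coordinate-drop : ∀ {l} {D : Pred Ord l} {β} → ¬ D β → ∀ p → coordinate β (keep D p) ≡ []
  coordinate-drop ¬d [] = ≡.refl
  coordinate-drop {D = D} {β} ¬d (e ∷ p) with em {P = D (key e)}
  ... | no _ = coordinate-drop ¬d p
  ... | yes d = ≡.trans (filter-reject (λ e → key e ≟ β) λ { ≡.refl → ¬d d }) (coordinate-drop ¬d p)

  infix 4 _~[_]_
  -- Equality of the conditions of P_α presented by p and q: the interleaving of coordinates and all
  -- entries from α on are forgotten.
  record _~[_]_ (p : List Entry) (α : Ord) (q : List Entry) : Set ℓ where
    constructor same
    field at : ∀ β → β < α → coordinate β p ≡ coordinate β q

  open _~[_]_

  ~-refl : ∀ {α p} → p ~[ α ] p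
  ~-refl = same λ _ _ → ≡.refl

  ~-sym : ∀ {α p q} → p ~[ α ] q → q ~[ α ] p
  ~-sym h = same λ β β<α → ≡.sym (at h β β<α)

  ~-trans : ∀ {α p q r} → p ~[ α ] q → q ~[ α ] r → p ~[ α ] r
  ~-trans h k = same λ β β<α → ≡.trans (at h β β<α) (at k β β<α)

  ~-++ : ∀ {α p p′ q q′} → p ~[ α ] p′ → q ~[ α ] q′ → p ++ q ~[ α ] p′ ++ q′
  ~-++ {p = p} {p′} h k = same λ β β<α → ≡.trans (coordinate-++ β p _)
    (≡.trans (≡.cong₂ _++_ (at h β β<α) (at k β β<α)) (≡.sym (coordinate-++ β p′ _)))

  ~-≮ : ∀ {α β p q} → ¬ β < α → p ~[ β ] q → p ~[ α ] q
  ~-≮ β≮α h = same λ γ γ<α → at h γ (<-≮-trans γ<α β≮α)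

  keep-~ : ∀ α p → keep (_< α) p ~[ α ] p
  keep-~ α p = same λ β β<α → coordinate-keep β<α p

  -- The regular open algebra of P_α is represented by these sets inside one ambient algebra, so
  -- inclusions between stages are literal.
  Supports : Ord → RegularOpen → Set ℓ
  Supports α U = ∀ p q → p ~[ α ] q → U ∋ p → U ∋ q

  supports-≮ : ∀ {α β} U → ¬ β < α → Supports α U → Supports β U
  supports-≮ U β≮α s p q p~q = s p q (~-≮ β≮α p~q)

  supports-regularize : ∀ {l α} {O : Pred (List Entry) l} → (∀ p q → p ~[ α ] q → O p → O q) → Supports α (regularize O)
  supports-regularize {α = α} {O} O-resp p q = regularize-invariant {_~_ = _~[ α ]_} {O = O}
    (λ t → ~-++ {p = t} ~-refl) (O-resp _ _)

  supports-≈ : ∀ {α U V} → U ≈ᵣ V → Supports α U → Supports α V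
  supports-≈ (U⊆V , V⊆U) s p q p~q v = U⊆V q (s p q p~q (V⊆U p v))

  supports-∧ : ∀ {α} U V → Supports α U → Supports α V → Supports α (U ∧ᵣ V)
  supports-∧ U V s t = supports-regularize {O = λ p → U ∋ p × V ∋ p} λ p q p~q (u , v) → s p q p~q u , t p q p~q v

  supports-∨ : ∀ {α} U V → Supports α U → Supports α V → Supports α (U ∨ᵣ V)
  supports-∨ U V s t = supports-regularize {O = λ p → U ∋ p ⊎ V ∋ p} λ where
    p q p~q (inj₁ u) → inj₁ (s p q p~q u)
    p q p~q (inj₂ v) → inj₂ (t p q p~q v)

  supports-⊥ : ∀ {α} → Supports α ⊥ᵣ
  supports-⊥ p q _ d = contradiction d ∌⊥ᵣ

  supports-⊤ : ∀ {α} → Supports α ⊤ᵣ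
  supports-⊤ p q _ _ = ∋⊤ᵣ

  supports-∁ : ∀ {α} U → Supports α U → Supports α (∁ᵣ U)
  supports-∁ U s p q p~q d = ∁ᵣ-intro U λ { (t , ≡.refl) u →
    ∁ᵣ-elim U (open- (∁ᵣ U) (t , ≡.refl) d) (s (t ++ q) (t ++ p) (~-++ {p = t} ~-refl (~-sym p~q)) u) }

  supported : (P : Pred Ord ℓ) → ∃ P → Subalgebra regularOpenAlgebra
  supported P (α₀ , pα₀) = record
    { member   = λ U → ∃[ α ] (P α × Supports α U)
    ; respects = λ { {U} {V} U≈V (α , pα , s) → α , pα , supports-≈ {α} {U} {V} U≈V s }
    ; ∨-closed = λ { {U} {V} (α , pα , s) (β , pβ , t) → let γ , pγ , α≤γ , β≤γ = join pα pβ
                   in γ , pγ , supports-∨ U V (supports-≮ U α≤γ s) (supports-≮ V β≤γ t) }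
    ; ∧-closed = λ { {U} {V} (α , pα , s) (β , pβ , t) → let γ , pγ , α≤γ , β≤γ = join pα pβ
                   in γ , pγ , supports-∧ U V (supports-≮ U α≤γ s) (supports-≮ V β≤γ t) }
    ; ¬-closed = λ { {U} (α , pα , s) → α , pα , supports-∁ U s }
    ; ⊤-closed = α₀ , pα₀ , supports-⊤
    ; ⊥-closed = α₀ , pα₀ , supports-⊥
    }
    where
    join : ∀ {α β} → P α → P β → ∃[ γ ] (P γ × ¬ γ < α × ¬ γ < β)
    join {α} {β} pα pβ with compare α β
    ... | tri< α<β _ _      = β , pβ , <-asym α<β , <-irrefl ≡.refl
    ... | tri≈ _ ≡.refl _   = β , pβ , <-irrefl ≡.refl , <-irrefl ≡.refl
    ... | tri> _ _ β<α      = α , pα , <-irrefl ≡.refl , <-asym β<α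

  Minimal : Pred Ord ℓ
  Minimal α = ∀ ξ → ¬ ξ < α

  minimum : ∃ Minimal
  minimum = let α , _ , min = least (λ α → α ≡ α) (proj₁ ω-small , ≡.refl) in α , λ ξ → min ξ ≡.refl

  -- The disjunct Minimal α makes stage 0 the two-element algebra.
  infix 4 _◁_
  _◁_ : Ord → Ord → Set ℓ
  α ◁ β = Minimal α ⊎ α < β

  ◁-≮ : ∀ {α β} → α ◁ β → ¬ β < α
  ◁-≮ (inj₁ min) = min _
  ◁-≮ (inj₂ α<β) = <-asym α<β

  boundedSets : Subalgebra regularOpenAlgebra
  boundedSets = supported (λ α → α ≡ α) (proj₁ ω-small , ≡.refl)

  𝔹 : BooleanAlgebra ℓ ℓ
  𝔹 = Subalgebra.algebra boundedSets

  -- Supports strictly below β, apart from the minimal ordinal, make the filtration continuous: at a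
  -- limit β, a support α < β is already below some γ < β. Admitting β itself as a support would
  -- break this.
  stage : Ord → Subalgebra 𝔹
  stage β = restrict boundedSets (supported (_◁ β) (proj₁ minimum , inj₁ (proj₂ minimum)))

  -- The projection to P_α of the cone below q. It is the reduction of any set that contains q, once
  -- α bounds the visible part of q.
  Cone : Ord → List Entry → RegularOpen
  Cone α q = regularize λ p → ∃[ t ] p ~[ α ] t ++ q

  cone-supports : ∀ α q → Supports α (Cone α q)
  cone-supports α q = supports-regularize {O = λ p → ∃[ t ] p ~[ α ] t ++ q}
    λ p p′ p~p′ (t , h) → t , ~-trans {p = p′} (~-sym p~p′) h

  ∋cone : ∀ α q → Cone α q ∋ q
  ∋cone α q = regularize-downset {O = λ p → ∃[ t ] p ~[ α ] t ++ q} λ { (t , ≡.refl) → t , ~-refl {α} {t ++ q} }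

  cone-meets : ∀ {α q p} U → U ∋ p → Cone α q ∋ p → ∃[ r ] ∃[ t ] (U ∋ r × r ~[ α ] t ++ q)
  cone-meets {α} {q} {p} U u d =
    let r , r≼p , t , h = regularize⁻ {O = λ p → ∃[ t ] p ~[ α ] t ++ q} d p ≼-refl
    in r , t , open- U r≼p u , h

  ≉⊥⇒inhabited : ∀ U → ¬ (U ≈ᵣ ⊥ᵣ) → ∃[ q ] U ∋ q
  ≉⊥⇒inhabited U U≉⊥ = decidable-stable em λ none →
    U≉⊥ ((λ q u → contradiction (q , u) none) , (λ _ d → contradiction d ∌⊥ᵣ))

  -- Only finitely many coordinates of q are visible to the sets in stage β.
  visible-bound : ∀ β q → ∃[ α ] (α ◁ β × (∀ γ α′ → α′ ◁ β → γ < α′ → ¬ γ < α → coordinate γ q ≡ []))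
  visible-bound β [] = proj₁ minimum , inj₁ (proj₂ minimum) , λ _ _ _ _ _ → ≡.refl
  visible-bound β (e ∷ q) = raise (visible-bound β q) em
    where
    skip : ∀ {γ} → ¬ key e ≡ γ → coordinate γ q ≡ [] → coordinate γ (e ∷ q) ≡ []
    skip {γ} ne eq = ≡.trans (filter-reject (λ e → key e ≟ γ) ne) eq
    raise : ∃[ α ] (α ◁ β × (∀ γ α′ → α′ ◁ β → γ < α′ → ¬ γ < α → coordinate γ q ≡ [])) →
      Dec (∃[ α′ ] (α′ ◁ β × key e < α′)) →
      ∃[ α ] (α ◁ β × (∀ γ α′ → α′ ◁ β → γ < α′ → ¬ γ < α → coordinate γ (e ∷ q) ≡ []))
    raise (α , α◁β , h) (no none) = α , α◁β , λ γ α′ α′◁β γ<α′ γ≮α →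
      skip (λ { ≡.refl → none (α′ , α′◁β , γ<α′) }) (h γ α′ α′◁β γ<α′ γ≮α)
    raise (α , α◁β , h) (yes (α″ , α″◁β , e<α″)) with em {P = α < α″}
    ... | yes α<α″ = α″ , α″◁β , λ γ α′ α′◁β γ<α′ γ≮α″ →
      skip (λ { ≡.refl → γ≮α″ e<α″ }) (h γ α′ α′◁β γ<α′ λ γ<α → γ≮α″ (<-trans γ<α α<α″))
    ... | no α≮α″ = α , α◁β , λ γ α′ α′◁β γ<α′ γ≮α →
      skip (λ { ≡.refl → γ≮α (<-≮-trans e<α″ α≮α″) }) (h γ α′ α′◁β γ<α′ γ≮α)

  stage-reductions : ∀ β {W} → Regularity.HasReductions em 𝔹 (stage β) W
  stage-reductions β {_} {U , _} _ U≉⊥ =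
    let q , q∈U = ≉⊥⇒inhabited U U≉⊥
        α , α◁β , h = visible-bound β q
    in (Cone α q , α , ≡.refl , cone-supports α q) , (α , α◁β , cone-supports α q)
     , (λ (C⊆⊥ , _) → ∌⊥ᵣ (C⊆⊥ q (∋cone α q)))
     , λ { {X , _} (α′ , α′◁β , s) (X⊥U , _) → (λ p d →
           let x , c = ∧ᵣ-elim X (Cone α q) d
               r , t , r∈X , r~ = cone-meets {α} {q} X x c
               -- Below α the extension follows t, from α on it copies r. There q has no entries
               -- visible to X, so `t′ ++ q` looks like r to X although it extends q.
               t′ = keep (_< α) t ++ keep (λ γ → ¬ γ < α) r
               r~t′ : r ~[ α′ ] t′ ++ q
               r~t′ = same λ γ γ<α′ → ≡.trans (agree q r t r~ (λ γ<α → h γ α′ α′◁β γ<α′ γ<α) em)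
                 (≡.sym (≡.trans (coordinate-++ γ t′ q) (≡.cong (_++ coordinate γ q) (coordinate-++ γ (keep (_< α) t) _))))
           in contradiction (X⊥U (t′ ++ q) (∧ᵣ-intro X U (s r (t′ ++ q) r~t′ r∈X) (open- U (t′ , ≡.refl) q∈U))) ∌⊥ᵣ)
         , (λ _ d → contradiction d ∌⊥ᵣ) }
    where
    agree : ∀ {α γ} q r t → r ~[ α ] t ++ q → (¬ γ < α → coordinate γ q ≡ []) → Dec (γ < α) →
      coordinate γ r ≡ (coordinate γ (keep (_< α) t) ++ coordinate γ (keep (λ γ → ¬ γ < α) r)) ++ coordinate γ q
    agree {α} {γ} q r t r~ h (yes γ<α) = ≡.trans (at r~ γ γ<α) (≡.trans (coordinate-++ γ t q)
      (≡.cong (_++ coordinate γ q) (≡.sym (≡.trans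
        (≡.cong₂ _++_ (coordinate-keep γ<α t) (coordinate-drop (λ γ≮α → γ≮α γ<α) r)) (++-identityʳ _)))))
    agree {α} {γ} q r t r~ h (no γ≮α) = ≡.sym (≡.trans
      (≡.cong₂ _++_ (≡.cong₂ _++_ (coordinate-drop γ≮α t) (coordinate-keep γ≮α r)) (h γ≮α)) (++-identityʳ _))

  -- A set supported by β is determined by its values on lists with keys below β. There are fewer
  -- than λ such lists, and the strong limit property bounds their subsets.
  stage-small : ∀ β → Small Λ (BooleanAlgebra.setoid (Subalgebra.algebra (stage β)))
  stage-small β = small-↪ inj (small-power (small-List (small-↪ entry-inj (small-× segment-small segment-small))))
    where
    Below : Set ℓ
    Below = Σ[ e ∈ Entry ] key e < β
    segment-small : Small Λ (≡.setoid (Segment β))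
    segment-small = β , record { to = λ ξ → ξ ; cong = λ eq → eq ; injective = λ eq → eq }
    entry-inj : Injection (≡.setoid Below) (≡.setoid (Segment β × Segment β))
    entry-inj = record
      { to        = λ ((ζ , ξ , ξ<ζ) , ζ<β) → (ζ , ζ<β) , (ξ , <-trans ξ<ζ ζ<β)
      ; cong      = ≡.cong _
      ; injective = λ {x} {y} eq → equal x y (≡.cong (proj₁ ∘ proj₁) eq) (≡.cong (proj₁ ∘ proj₂) eq)
      }
      where
      equal : ∀ (x y : Below) → key (proj₁ x) ≡ key (proj₁ y) → proj₁ (proj₂ (proj₁ x)) ≡ proj₁ (proj₂ (proj₁ y)) → x ≡ y
      equal ((ζ , ξ , p) , r) ((ζ , ξ , q) , s) ≡.refl ≡.refl =
        ≡.cong₂ (λ p r → (ζ , ξ , p) , r) (<-irrelevant p q) (<-irrelevant r s)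
    lift : ∀ p → ∃[ x ] p ~[ β ] map proj₁ x
    lift [] = [] , ~-refl
    lift (e ∷ p) with em {P = key e < β} | lift p
    ... | yes e<β | x , h = (e , e<β) ∷ x , ~-++ {p = e ∷ []} ~-refl h
    ... | no e≮β  | x , h = x , same λ γ γ<β →
      ≡.trans (filter-reject (λ e → key e ≟ γ) λ { ≡.refl → e≮β γ<β }) (at h γ γ<β)
    transfer : ∀ U V → Supports β U → Supports β V →
      (∀ x → char U (map proj₁ x) ≡ char V (map proj₁ x)) → U ⊆ᵣ V
    transfer U V s t eq p u =
      let x , p~x = lift p
      in t (map proj₁ x) p (~-sym p~x) (≡.subst T (eq x) (s p (map proj₁ x) p~x u))
    stage-support : ∀ (x : Σ (BooleanAlgebra.Carrier 𝔹) (Subalgebra.member (stage β))) → Supports β (proj₁ (proj₁ x))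
    stage-support ((U , _) , α , α◁β , s) = supports-≮ U (◁-≮ α◁β) s
    inj : Injection (BooleanAlgebra.setoid (Subalgebra.algebra (stage β))) (List Below →-setoid Bool)
    inj = record
      { to        = λ ((U , _) , _) x → char U (map proj₁ x)
      ; cong      = λ (U⊆V , V⊆U) x → T-extensional (U⊆V (map proj₁ x)) (V⊆U (map proj₁ x))
      ; injective = λ { {x@((U , _) , _)} {y@((V , _) , _)} eq →
            transfer U V (stage-support x) (stage-support y) eq
          , transfer V U (stage-support y) (stage-support x) (≡.sym ∘ eq) }
      }

  𝔹-inBoolSeq : InBoolSeq Λ 𝔹
  𝔹-inBoolSeq = record
    { sub        = stage
    ; inBool     = λ α → (λ (⊤⊆⊥ , _) → ∌⊥ᵣ (⊤⊆⊥ [] ∋⊤ᵣ)) , stage-small α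
    ; increasing = λ {α} {β} α<β → Regularity.hasReductions⇒⊑ em 𝔹 {stage α} {stage β}
        (λ (γ , γ◁α , s) → γ , ◁-<-trans γ◁α α<β , s) (λ {w} → stage-reductions α {stage β} {w})
    ; continuous = λ { β ((α₀ , α₀<β) , next) (γ , inj₁ min , s) → α₀ , α₀<β , γ , inj₁ min , s
                     ; β (_ , next) (γ , inj₂ γ<β , s) → let δ , γ<δ , δ<β = next γ γ<β in δ , δ<β , γ , inj₂ γ<δ , s }
    ; covers     = λ (U , α , _ , s) → let γ , α<γ = above α in γ , α , inj₂ α<γ , s
    }
    where
    ◁-<-trans : ∀ {γ α β} → γ ◁ α → α < β → γ ◁ β
    ◁-<-trans (inj₁ min) _   = inj₁ min
    ◁-<-trans (inj₂ γ<α) α<β = inj₂ (<-trans γ<α α<β)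

-- Injectivity of the collapse algebra

module CollapseInjective (em : ∀ {a} → ExcludedMiddle a) {ℓ} (Λ : WellOrder ℓ) (inacc : IsStronglyInaccessible Λ) where
  open Cardinals em Λ inacc
  open CollapseAlgebra em Λ inacc
  open IsStrictTotalOrder (WellOrder.isStrictTotalOrder Λ) using (_≟_)

  module Extend (C : BooleanAlgebra ℓ ℓ) (B : Subalgebra C)
    (B-small : Small Λ (BooleanAlgebra.setoid (Subalgebra.algebra B)))
    (C-small : Small Λ (BooleanAlgebra.setoid C)) (B-regular : IsRegular C B)
    (f : RegularEmbedding (Subalgebra.algebra B) 𝔹) where
    private
      module C = BooleanAlgebra C
      module B = BooleanAlgebra (Subalgebra.algebra B)
    open Rank Λ C-small

    f↑ : Embedding (Subalgebra.algebra B) regularOpenAlgebra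
    f↑ = inclusion boundedSets ∘ₑ RegularEmbedding.embedding f

    f↑-open : B.Carrier → RegularOpen
    f↑-open = Embedding.to f↑

    support : ∃[ α ] (∀ b → Supports α (f↑-open b))
    support = bounded B-small (λ b α → Supports α (f↑-open b))
      (λ {x} {y} {α} x≈y → supports-≈ {α} {f↑-open x} {f↑-open y} (Embedding.⟦⟧-cong f↑ {x} {y} x≈y))
      (λ {x} α<β → supports-≮ (f↑-open x) (<-asym α<β))
      (λ b → let α , _ , s = proj₂ (RegularEmbedding.to f b) in α , s)

    α : Ord
    α = proj₁ support

    f↑-supports : ∀ b → Supports α (f↑-open b)
    f↑-supports = proj₂ support

    -- Being above α makes this coordinate invisible to f; being above the codes of C gives every
    -- element of C an entry at it.
    β : Ord
    β = proj₁ (above₂ α bound)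

    α<β : α < β
    α<β = proj₁ (proj₂ (above₂ α bound))

    encode : C.Carrier → Entry
    encode c = β , rank c , <-trans (rank<bound c) (proj₂ (proj₂ (above₂ α bound)))

    encode-injective : ∀ {c d} → encode c ≡ encode d → c C.≈ d
    encode-injective {c} {d} eq = rank-injective (≡.cong (proj₁ ∘ proj₂) eq)

    decode′ : ∀ {e} → Dec (∃[ c ] encode c ≡ e) → List C.Carrier
    decode′ (yes (c , _)) = c ∷ []
    decode′ (no _)        = []

    -- Entries at other coordinates, and entries at β that code nothing, propose no move.
    decode : Entry → List C.Carrier
    decode e = decode′ {e} em

    path : List Entry → List C.Carrier
    path = concatMap decode

    enter : ∀ c → ∃[ e ] ∃[ c′ ] (c′ C.≈ c × path (e ∷ []) ≡ c′ ∷ [])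
    enter c = encode c , lemma em
      where
      lemma : (d : Dec (∃[ c′ ] encode c′ ≡ encode c)) → ∃[ c′ ] (c′ C.≈ c × decode′ {encode c} d ++ [] ≡ c′ ∷ [])
      lemma (yes (c′ , eq)) = c′ , encode-injective eq , ≡.refl
      lemma (no none)       = contradiction (c , ≡.refl) none

    decode-other : ∀ {e} → ¬ key e ≡ β → decode e ≡ []
    decode-other {e} ne with em {P = ∃[ c ] encode c ≡ e}
    ... | yes (c , eq) = contradiction (≡.sym (≡.cong key eq)) ne
    ... | no _         = ≡.refl

    path-coordinate : ∀ p → path (coordinate β p) ≡ path p
    path-coordinate [] = ≡.refl
    path-coordinate (e ∷ p) with key e ≟ β
    ... | yes _ = ≡.cong (decode e ++_) (path-coordinate p)
    ... | no ne = ≡.trans (path-coordinate p) (≡.cong (_++ path p) (≡.sym (decode-other ne)))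

    path-~ : ∀ {γ p q} → β < γ → p ~[ γ ] q → path p ≡ path q
    path-~ {p = p} {q} β<γ p~q = ≡.trans (≡.sym (path-coordinate p))
      (≡.trans (≡.cong path (_~[_]_.at p~q β β<γ)) (path-coordinate q))

    -- Entries of t from α on are discarded: values of f do not see them, and what remains lies
    -- below β and so does not move the path.
    idle : ∀ b t q → f↑-open b ∋ (t ++ q) → ∃[ u ] (path u ≡ [] × f↑-open b ∋ (u ++ q))
    idle b t q p = keep (_< α) t
      , ≡.trans (≡.sym (path-coordinate (keep (_< α) t))) (≡.cong path (coordinate-drop (<-asym α<β) t))
      , f↑-supports b (t ++ q) (keep (_< α) t ++ q) (~-++ {p = t} (~-sym (keep-~ α t)) ~-refl) p

    B-reductions : Reductions (RegularEmbedding.embedding f)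
    B-reductions = RegularEmbeddings.reductions em Λ B-small f

    -- Regularity of f in `𝔹` is applied to the cone of q over α. Sets supported by α that meet this
    -- cone also contain an honest extension of q.
    f↑-reductions : ∀ q → ∃[ b ] (b B.≉ B.⊥ ×
      (∀ x → (∀ {r} → r ≼ q → ¬ (f↑-open x ∋ r)) → x B.∧ b B.≈ B.⊥))
    f↑-reductions q =
      let cone = Cone α q , α , ≡.refl , cone-supports α q
          b , b≉⊥ , red = B-reductions cone (λ (C⊆⊥ , _) → ∌⊥ᵣ (C⊆⊥ q (∋cone α q)))
      in b , b≉⊥ , λ x none → red x
        ( (λ p d →
            let x∋p , c = ∧ᵣ-elim (f↑-open x) (Cone α q) d
                r , t , x∋r , r~ = cone-meets {α} {q} (f↑-open x) x∋p c
            in contradiction (f↑-supports x r (t ++ q) r~ x∋r) (none (t , ≡.refl)))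
        , (λ _ d → contradiction d ∌⊥ᵣ))

    absorbed = GenericPaths.Absorption.absorb em Entry {B = Subalgebra.algebra B} {C = C}
      (inclusion B) (SmallRegularity.inclusion-reductions em Λ C B B-small B-regular) f↑ f↑-reductions
      path (concatMap-++ decode) ≡.refl enter idle

    h : Embedding C regularOpenAlgebra
    h = proj₁ absorbed

    -- The path reads coordinate β only and f depends on coordinates below α < β, so every γ above β
    -- is a support.
    h-bounded : ∀ c → Embedding.to h c ∈ Subalgebra.member boundedSets
    h-bounded c =
      let γ , β<γ = above β
      in γ , ≡.refl , λ p q → proj₂ (proj₂ (proj₂ absorbed)) {_~_ = _~[ γ ]_} (λ t → ~-++ {p = t} ~-refl)
           (path-~ β<γ) (λ b {p} {q} p~q → f↑-supports b p q (~-≮ (<-asym (<-trans α<β β<γ)) p~q)) c {p} {q}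

    extension : RegularEmbedding C 𝔹
    extension = RegularEmbeddings.mkRegularEmbedding em (corestrict boundedSets h h-bounded)
      (λ (U , _) → proj₁ (proj₂ (proj₂ absorbed)) U)

    extends : ∀ b → BooleanAlgebra._≈_ 𝔹 (RegularEmbedding.to extension (proj₁ b)) (RegularEmbedding.to f b)
    extends = proj₁ (proj₂ absorbed)

  𝔹-injective : IsInjective Λ 𝔹
  𝔹-injective C B (_ , B-small) (_ , C-small) B-regular f = extension , extends
    where open Extend C B B-small C-small B-regular f

-- Two-element subalgebras, joint embedding and amalgamation

module _ {ℓ} (B : BooleanAlgebra ℓ ℓ) where
  open BooleanAlgebra B renaming (¬_ to ∁_)
  open BooleanOrder B

  -- The base for unconstrained extension problems: it is regular in every nondegenerate algebra and
  -- maps regularly into every other, so injectivity yields universality and the back-and-forth has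
  -- a starting point.
  twoElement : Subalgebra B
  twoElement = record
    { member   = λ x → x ≈ ⊤ ⊎ x ≈ ⊥
    ; respects = λ { x≈y (inj₁ p) → inj₁ (trans (sym x≈y) p) ; x≈y (inj₂ p) → inj₂ (trans (sym x≈y) p) }
    ; ∨-closed = λ { (inj₁ p) _ → inj₁ (trans (∨-congʳ p) (trans (∨-comm _ _) (∨-⊤ _)))
                   ; (inj₂ p) (inj₁ q) → inj₁ (trans (∨-congˡ q) (∨-⊤ _))
                   ; (inj₂ p) (inj₂ q) → inj₂ (trans (∨-cong p q) (∨-idem ⊥)) }
    ; ∧-closed = λ { (inj₂ p) _ → inj₂ (trans (∧-congʳ p) (∧-zeroˡ _))
                   ; (inj₁ p) (inj₂ q) → inj₂ (trans (∧-congˡ q) (∧-zeroʳ _))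
                   ; (inj₁ p) (inj₁ q) → inj₁ (trans (∧-cong p q) (∧-idem ⊤)) }
    ; ¬-closed = λ { (inj₁ p) → inj₂ (trans (¬-cong p) ¬⊤≈⊥) ; (inj₂ p) → inj₁ (trans (¬-cong p) ¬⊥≈⊤) }
    ; ⊤-closed = inj₁ refl
    ; ⊥-closed = inj₂ refl
    }
    where
    ∨-⊤ : ∀ x → x ∨ ⊤ ≈ ⊤
    ∨-⊤ x = antisym (⊤-greatest _) (y≤x∨y x ⊤)

module TwoElement (em : ∀ {a} → ExcludedMiddle a) {ℓ} (A B : BooleanAlgebra ℓ ℓ)
  (A-nondegenerate : BooleanAlgebra._≉_ A (BooleanAlgebra.⊤ A) (BooleanAlgebra.⊥ A))
  (B-nondegenerate : BooleanAlgebra._≉_ B (BooleanAlgebra.⊤ B) (BooleanAlgebra.⊥ B)) where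
  private
    module A = BooleanAlgebra A
    module B = BooleanAlgebra B
    module B≤ = BooleanOrder B
    module A≤ = BooleanOrder A

  twoElement-hasReductions : ∀ {W} → Regularity.HasReductions em A (twoElement A) W
  twoElement-hasReductions {_} {w} _ w≉⊥ = A.⊤ , inj₁ A.refl , A-nondegenerate , λ where
    (inj₁ x≈⊤) x⊥w → contradiction (A.trans (A.sym (A≤.∧-identityˡ w)) (A.trans (A.∧-congʳ (A.sym x≈⊤)) x⊥w)) w≉⊥
    (inj₂ x≈⊥) _   → A.trans (A.∧-congʳ x≈⊥) (A≤.∧-zeroˡ _)

  twoElement-regular : IsRegular A (twoElement A)
  twoElement-regular = Regularity.hasReductions⇒⊑ em A {twoElement A} {whole A} _ (λ {w} → twoElement-hasReductions {whole A} {w})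

  twoElement-to : Σ A.Carrier (Subalgebra.member (twoElement A)) → B.Carrier
  twoElement-to (_ , inj₁ _) = B.⊤
  twoElement-to (_ , inj₂ _) = B.⊥

  twoElement-embedding : Embedding (Subalgebra.algebra (twoElement A)) B
  twoElement-embedding = mkEmbedding twoElement-to
    (λ { {_ , inj₁ _} {_ , inj₁ _} _   → B.refl
       ; {_ , inj₁ p} {_ , inj₂ q} x≈y → contradiction (A.trans (A.sym p) (A.trans x≈y q)) A-nondegenerate
       ; {_ , inj₂ p} {_ , inj₁ q} x≈y → contradiction (A.trans (A.sym q) (A.trans (A.sym x≈y) p)) A-nondegenerate
       ; {_ , inj₂ _} {_ , inj₂ _} _   → B.refl })
    (λ { (_ , inj₂ _) (_ , _)      → B.sym (B≤.∧-zeroˡ _)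
       ; (_ , inj₁ _) (_ , inj₂ _) → B.sym (B≤.∧-zeroʳ _)
       ; (_ , inj₁ _) (_ , inj₁ _) → B.sym (B≤.∧-idem _) })
    (λ { (_ , inj₁ _) → B.sym B≤.¬⊤≈⊥ ; (_ , inj₂ _) → B.sym B≤.¬⊥≈⊤ })
    (λ { (_ , inj₁ _) eq → contradiction eq B-nondegenerate ; (_ , inj₂ p) _ → p })

  twoElement-reductions : Reductions twoElement-embedding
  twoElement-reductions b b≉⊥ = (A.⊤ , inj₁ A.refl) , A-nondegenerate , λ where
    (x , inj₁ x≈⊤) ⊤⊥b → contradiction (B.trans (B.sym (B≤.∧-identityˡ b)) ⊤⊥b) b≉⊥
    (x , inj₂ x≈⊥) _   → A.trans (A.∧-congʳ x≈⊥) (A≤.∧-zeroˡ _)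

module SmallAlgebras (em : ∀ {a} → ExcludedMiddle a) {ℓ} (Λ : WellOrder ℓ) (inacc : IsStronglyInaccessible Λ) where
  open Cardinals em Λ inacc

  subalgebra-small : ∀ (B : BooleanAlgebra ℓ ℓ) (V : Subalgebra B) → Small Λ (BooleanAlgebra.setoid B) →
    Small Λ (BooleanAlgebra.setoid (Subalgebra.algebra V))
  subalgebra-small B V = small-↪ (record { to = proj₁ ; cong = λ eq → eq ; injective = λ eq → eq })

  module Filtration (𝔸 : BooleanAlgebra ℓ ℓ) (seq : InBoolSeq Λ 𝔸) where
    open InBoolSeq seq public
    private module 𝔸 = BooleanAlgebra 𝔸

    stageAlgebra : Ord → BooleanAlgebra ℓ ℓ
    stageAlgebra α = Subalgebra.algebra (sub α)

    sub-≮ : ∀ {α β x} → ¬ β < α → x ∈ Subalgebra.member (sub α) → x ∈ Subalgebra.member (sub β)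
    sub-≮ {α} {β} β≮α x∈ with compare α β
    ... | tri< α<β _ _    = proj₁ (increasing α<β) x∈
    ... | tri≈ _ ≡.refl _ = x∈
    ... | tri> _ _ β<α    = contradiction β<α β≮α

    nondegenerate : 𝔸.⊤ 𝔸.≉ 𝔸.⊥
    nondegenerate = proj₁ (inBool (proj₁ ω-small))

    twoElement-small : Small Λ (BooleanAlgebra.setoid (Subalgebra.algebra (twoElement 𝔸)))
    twoElement-small = small-↪ (record { to = λ (x , two) → x , twoElement⊆sub two ; cong = λ eq → eq ; injective = λ eq → eq })
        (proj₂ (inBool α))
      where
      α : Ord
      α = proj₁ ω-small
      twoElement⊆sub : Subalgebra.member (twoElement 𝔸) ⊆ Subalgebra.member (sub α)
      twoElement⊆sub (inj₁ x≈⊤) = Subalgebra.respects (sub α) (𝔸.sym x≈⊤) (Subalgebra.⊤-closed (sub α))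
      twoElement⊆sub (inj₂ x≈⊥) = Subalgebra.respects (sub α) (𝔸.sym x≈⊥) (Subalgebra.⊥-closed (sub α))

    contains-small : ∀ {a e} {S : Setoid a e} → Small Λ S → (φ : Setoid.Carrier S → 𝔸.Carrier) →
      (∀ {x y} → Setoid._≈_ S x y → φ x 𝔸.≈ φ y) → ∃[ γ ] (∀ x → φ x ∈ Subalgebra.member (sub γ))
    contains-small {S = S} S-small φ φ-cong = bounded {S = S} S-small (λ x α → φ x ∈ Subalgebra.member (sub α))
      (λ {_} {_} {α} x≈y → Subalgebra.respects (sub α) (φ-cong x≈y))
      (λ α<β → sub-≮ (<-asym α<β)) (λ x → covers (φ x))

    -- Regularity is given only between stages, but w lies in some stage: a later one supplies a
    -- reduction, and in stage α itself w is its own reduction.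
    sub-hasReductions : ∀ α {W} → Regularity.HasReductions em 𝔸 (sub α) W
    sub-hasReductions α {_} {w} _ w≉⊥ = let β , w∈β = covers w in lemma w∈β
      where
      lemma : ∀ {β} → w ∈ Subalgebra.member (sub β) → ∃[ v ] (v ∈ Subalgebra.member (sub α) × v 𝔸.≉ 𝔸.⊥ ×
        (∀ {x} → x ∈ Subalgebra.member (sub α) → x 𝔸.∧ w 𝔸.≈ 𝔸.⊥ → x 𝔸.∧ v 𝔸.≈ 𝔸.⊥))
      lemma {β} w∈β with em {P = α < β}
      ... | yes α<β = SmallRegularity.⊑⇒hasReductions em Λ 𝔸 {sub α} {sub β} (proj₂ (inBool α)) (increasing α<β) w∈β w≉⊥
      ... | no α≮β = w , sub-≮ α≮β w∈β , w≉⊥ , λ _ eq → eq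

    corestrict-stage : ∀ {A : BooleanAlgebra ℓ ℓ} (f : RegularEmbedding A 𝔸) → Small Λ (BooleanAlgebra.setoid A) → ∀ γ →
      (∀ x → RegularEmbedding.to f x ∈ Subalgebra.member (sub γ)) → RegularEmbedding A (stageAlgebra γ)
    corestrict-stage f A-small γ f∈ = RegularEmbeddings.mkRegularEmbedding em
      (corestrict (sub γ) (RegularEmbedding.embedding f) f∈)
      (λ (b , _) → RegularEmbeddings.reductions em Λ A-small f b)

  module Injective (𝔸 : BooleanAlgebra ℓ ℓ) (seq : InBoolSeq Λ 𝔸) (inj : IsInjective Λ 𝔸) where
    open Filtration 𝔸 seq

    universal : ∀ A → InBool Λ A → RegularEmbedding A 𝔸
    universal A (A-nondeg , A-small) = proj₁ (inj A (twoElement A)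
        (A-nondeg , subalgebra-small A (twoElement A) A-small) (A-nondeg , A-small) twoElement-regular
        (RegularEmbeddings.mkRegularEmbedding em twoElement-embedding twoElement-reductions))
      where open TwoElement em A 𝔸 A-nondeg nondegenerate

    commonStage : ∀ {A B} → InBool Λ A → InBool Λ B → (f : RegularEmbedding A 𝔸) (g : RegularEmbedding B 𝔸) →
      ∃[ γ ] ((∀ x → RegularEmbedding.to f x ∈ Subalgebra.member (sub γ)) ×
              (∀ x → RegularEmbedding.to g x ∈ Subalgebra.member (sub γ)))
    commonStage (_ , A-small) (_ , B-small) f g =
      let α , f∈ = contains-small A-small (RegularEmbedding.to f) (RegularEmbedding.⟦⟧-cong f)
          β , g∈ = contains-small B-small (RegularEmbedding.to g) (RegularEmbedding.⟦⟧-cong g)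
          γ , α<γ , β<γ = above₂ α β
      in γ , (λ x → sub-≮ (<-asym α<γ) (f∈ x)) , (λ x → sub-≮ (<-asym β<γ) (g∈ x))

    jointEmbedding : JointEmbedding Λ
    jointEmbedding A B A∈ B∈ =
      let f = universal A A∈
          g = universal B B∈
          γ , f∈ , g∈ = commonStage A∈ B∈ f g
      in stageAlgebra γ , inBool γ , corestrict-stage f (proj₂ A∈) γ f∈ , corestrict-stage g (proj₂ B∈) γ g∈

    -- Injectivity speaks of subalgebras, so A is replaced by its image in C. The embedding of B
    -- into `𝔸`, pulled back to this image, is extended to all of C, and a common stage contains
    -- both ranges.
    amalgamation : Amalgamation Λ
    amalgamation A B C A∈ B∈ C∈ f g =
      let f′ = universal B B∈
          f″ = RegularEmbedding.embedding f′
          k = f″ ∘ₑ f.embedding ∘ₑ g⁻¹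
          k-reductions = ∘-reductions f″ (f.embedding ∘ₑ g⁻¹) (RegularEmbeddings.reductions em Λ (proj₂ B∈) f′)
            (∘-reductions f.embedding g⁻¹ (RegularEmbeddings.reductions em Λ (proj₂ A∈) f) g⁻¹-reductions)
          g′ , extends = inj C g.image (proj₁ C∈ , RegularEmbeddings.image-small em Λ g.embedding (proj₂ A∈)) C∈
            g.isRegular (RegularEmbeddings.mkRegularEmbedding em k k-reductions)
          γ , f′∈ , g′∈ = commonStage B∈ C∈ f′ g′
      in stageAlgebra γ , inBool γ , corestrict-stage f′ (proj₂ B∈) γ f′∈ , corestrict-stage g′ (proj₂ C∈) γ g′∈
       , λ x → BooleanAlgebra.sym 𝔸 (extends (g.to x , x , BooleanAlgebra.refl C))
      where
      module f = RegularEmbedding f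
      module g = RegularEmbedding g
      module A = BooleanAlgebra A
      module C = BooleanAlgebra C
      g⁻¹ : Embedding (Subalgebra.algebra g.image) A
      g⁻¹ = mkEmbedding (λ (_ , x , _) → x)
        (λ { {_ , x , p} {_ , y , q} eq → g.injective (C.trans p (C.trans eq (C.sym q))) })
        (λ _ _ → A.refl) (λ _ → A.refl)
        (λ { (_ , x , p) x≈⊥ → C.trans (C.sym p) (C.trans (g.⟦⟧-cong x≈⊥) g.⊥-homo) })
      g⁻¹-reductions : Reductions g⁻¹
      g⁻¹-reductions a a≉⊥ = (g.to a , a , C.refl) , (λ eq → a≉⊥ (EmbeddingKernel.kernel g.embedding eq))
        , λ { (_ , x , p) x⊥a → C.trans (C.∧-congʳ (C.sym p)) (C.trans (C.sym (g.∧-homo x a)) (C.trans (g.⟦⟧-cong x⊥a) g.⊥-homo)) }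

-- Unions of short chains

module Unions (em : ∀ {a} → ExcludedMiddle a) (choice : ∀ {a e b r} → ExtensionalChoice a e b r)
  {ℓ} (Λ : WellOrder ℓ) (inacc : IsStronglyInaccessible Λ) where
  open Cardinals em Λ inacc
  open SmallAlgebras em Λ inacc using (subalgebra-small)

  closedUnderRegularSubalgebras : ClosedUnderRegularSubalgebras Λ
  closedUnderRegularSubalgebras B (B-nondeg , B-small) V _ = B-nondeg , subalgebra-small B V B-small

  module _ (δ : Ord) (δ-limit : IsLimit _<_ δ) (A : Sequence {I = Segment δ} (_<_ on proj₁)) where
    open Sequence A
    private
      module A ξ = BooleanAlgebra (alg ξ)
      module I {α β : Segment δ} (p : proj₁ α < proj₁ β) = RegularEmbedding (incl {α} {β} p)

      infix 4 _<ₛ_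
      _<ₛ_ : Segment δ → Segment δ → Set ℓ
      _<ₛ_ = _<_ on proj₁

    index₀ : Segment δ
    index₀ = proj₁ δ-limit

    max : ∀ (α β : Segment δ) → ∃[ γ ] (∀ ξ → γ <ₛ ξ → α <ₛ ξ × β <ₛ ξ)
    max α β with compare (proj₁ α) (proj₁ β)
    ... | tri< α<β _ _    = β , λ _ β<ξ → <-trans α<β β<ξ , β<ξ
    ... | tri≈ _ ≡.refl _ = β , λ _ β<ξ → β<ξ , β<ξ
    ... | tri> _ _ β<α    = α , λ _ α<ξ → α<ξ , <-trans β<α α<ξ

    next : ∀ (α : Segment δ) → ∃[ γ ] α <ₛ γ
    next (α , α<δ) = let γ , α<γ , γ<δ = proj₂ δ-limit α α<δ in (γ , γ<δ) , α<γ

    beyond : ∀ (α β : Segment δ) → ∃[ γ ] (α <ₛ γ × β <ₛ γ)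
    beyond α β = let μ , h = max α β
                     γ , μ<γ = next μ
                 in γ , h γ μ<γ

    Family : Set ℓ
    Family = ∀ ξ → A.Carrier ξ

    infix 4 _≈∞_
    _≈∞_ : Family → Family → Set ℓ
    s ≈∞ t = ∃[ α ] (∀ β → α <ₛ β → A._≈_ β (s β) (t β))

    private
      always : ∀ {s t} → (∀ β → A._≈_ β (s β) (t β)) → s ≈∞ t
      always h = index₀ , λ β _ → h β

      both : ∀ {s s′ t t′ u v} → (∀ β → A._≈_ β (s β) (s′ β) → A._≈_ β (t β) (t′ β) → A._≈_ β (u β) (v β)) →
        s ≈∞ s′ → t ≈∞ t′ → u ≈∞ v
      both h (α , p) (β , q) = let γ , up = max α β in γ , λ ξ γ<ξ →
        let α<ξ , β<ξ = up ξ γ<ξ in h ξ (p ξ α<ξ) (q ξ β<ξ)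

    -- The union is realised inside the product of the sequence modulo eventual equality.
    reducedProduct : BooleanAlgebra ℓ ℓ
    reducedProduct = record
      { Carrier = Family
      ; _≈_ = _≈∞_
      ; _∨_ = λ s t ξ → A._∨_ ξ (s ξ) (t ξ)
      ; _∧_ = λ s t ξ → A._∧_ ξ (s ξ) (t ξ)
      ; ¬_ = λ s ξ → A.¬_ ξ (s ξ)
      ; ⊤ = A.⊤
      ; ⊥ = A.⊥
      ; isBooleanAlgebra = record
        { isDistributiveLattice = record
          { isLattice = record
            { isEquivalence = record
              { refl  = always λ ξ → A.refl ξ
              ; sym   = λ (α , p) → α , λ ξ α<ξ → A.sym ξ (p ξ α<ξ)
              ; trans = both λ ξ → A.trans ξ
              }
            ; ∨-comm     = λ _ _ → always λ ξ → A.∨-comm ξ _ _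
            ; ∨-assoc    = λ _ _ _ → always λ ξ → A.∨-assoc ξ _ _ _
            ; ∨-cong     = both λ ξ → A.∨-cong ξ
            ; ∧-comm     = λ _ _ → always λ ξ → A.∧-comm ξ _ _
            ; ∧-assoc    = λ _ _ _ → always λ ξ → A.∧-assoc ξ _ _ _
            ; ∧-cong     = both λ ξ → A.∧-cong ξ
            ; absorptive = (λ _ _ → always λ ξ → A.∨-absorbs-∧ ξ _ _) , (λ _ _ → always λ ξ → A.∧-absorbs-∨ ξ _ _)
            }
          ; ∨-distrib-∧ = (λ _ _ _ → always λ ξ → A.∨-distribˡ-∧ ξ _ _ _) , (λ _ _ _ → always λ ξ → A.∨-distribʳ-∧ ξ _ _ _)
          ; ∧-distrib-∨ = (λ _ _ _ → always λ ξ → A.∧-distribˡ-∨ ξ _ _ _) , (λ _ _ _ → always λ ξ → A.∧-distribʳ-∨ ξ _ _ _)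
          }
        ; ∨-complement = (λ _ → always λ ξ → A.∨-complementˡ ξ _) , (λ _ → always λ ξ → A.∨-complementʳ ξ _)
        ; ∧-complement = (λ _ → always λ ξ → A.∧-complementˡ ξ _) , (λ _ → always λ ξ → A.∧-complementʳ ξ _)
        ; ¬-cong       = λ (α , p) → α , λ ξ α<ξ → A.¬-cong ξ (p ξ α<ξ)
        }
      }

    IsThread : Pred Family ℓ
    IsThread s = ∃[ α ] ∃[ x ] (∀ β (p : α <ₛ β) → A._≈_ β (s β) (I.to {α} {β} p x))

    private
      module Combine {op : ∀ ξ → A.Carrier ξ → A.Carrier ξ → A.Carrier ξ}
        (op-cong : ∀ ξ {x y u v} → A._≈_ ξ x y → A._≈_ ξ u v → A._≈_ ξ (op ξ x u) (op ξ y v))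
        (op-homo : ∀ {α β} (p : α <ₛ β) x y → A._≈_ β (I.to {α} {β} p (op α x y)) (op β (I.to {α} {β} p x) (I.to {α} {β} p y)))
        where
        closed : ∀ {s t} → IsThread s → IsThread t → IsThread (λ ξ → op ξ (s ξ) (t ξ))
        closed (α , x , s≈) (β , y , t≈) =
          let γ , p , q = beyond α β
          in γ , op γ (I.to {α} {γ} p x) (I.to {β} {γ} q y) , λ ξ r → A.trans ξ
               (op-cong ξ (A.trans ξ (s≈ ξ (<-trans p r)) (A.sym ξ (incl-∘ {α} {γ} {ξ} p r (<-trans p r) x)))
                          (A.trans ξ (t≈ ξ (<-trans q r)) (A.sym ξ (incl-∘ {β} {γ} {ξ} q r (<-trans q r) y))))
               (A.sym ξ (op-homo {γ} {ξ} r _ _))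

    threads : Subalgebra reducedProduct
    threads = record
      { member   = IsThread
      ; respects = λ { {s} {t} (α , p) (β , x , s≈) →
          let γ , α<γ , β<γ = beyond α β
          in γ , I.to {β} {γ} β<γ x , λ ξ γ<ξ → A.trans ξ (A.sym ξ (p ξ (<-trans α<γ γ<ξ)))
               (A.trans ξ (s≈ ξ (<-trans β<γ γ<ξ)) (A.sym ξ (incl-∘ {β} {γ} {ξ} β<γ γ<ξ (<-trans β<γ γ<ξ) x))) }
      ; ∨-closed = Combine.closed (λ ξ → A.∨-cong ξ) (λ {α} {β} p → I.∨-homo {α} {β} p)
      ; ∧-closed = Combine.closed (λ ξ → A.∧-cong ξ) (λ {α} {β} p → I.∧-homo {α} {β} p)
      ; ¬-closed = λ { (α , x , s≈) → α , A.¬_ α x , λ β p → A.trans β (A.¬-cong β (s≈ β p)) (A.sym β (I.¬-homo {α} {β} p x)) }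
      ; ⊤-closed = index₀ , A.⊤ index₀ , λ β p → A.sym β (I.⊤-homo {index₀} {β} p)
      ; ⊥-closed = index₀ , A.⊥ index₀ , λ β p → A.sym β (I.⊥-homo {index₀} {β} p)
      }

    union : BooleanAlgebra ℓ ℓ
    union = Subalgebra.algebra threads

    thread′ : ∀ α β → A.Carrier α → Dec (α <ₛ β) → A.Carrier β
    thread′ α β x (yes p) = I.to {α} {β} p x
    -- The default is also taken at β = α; it is harmless because families are compared only on a
    -- tail.
    thread′ α β x (no _)  = A.⊥ β

    thread : ∀ α → A.Carrier α → Family
    thread α x β = thread′ α β x em

    thread-at : ∀ α β (p : α <ₛ β) x → A._≈_ β (thread α x β) (I.to {α} {β} p x)
    thread-at α β p x = lemma em
      where
      lemma : (d : Dec (α <ₛ β)) → A._≈_ β (thread′ α β x d) (I.to {α} {β} p x)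
      lemma (yes q) = A.reflexive β (≡.cong (λ p → I.to {α} {β} p x) (<-irrelevant q p))
      lemma (no ¬p) = contradiction p ¬p

    thread-embedding : ∀ α → Embedding (alg α) union
    thread-embedding α = mkEmbedding (λ x → thread α x , α , x , λ β p → thread-at α β p x)
      (λ {x} {y} x≈y → α , λ β p → A.trans β (thread-at α β p x) (A.trans β (I.⟦⟧-cong {α} {β} p x≈y) (A.sym β (thread-at α β p y))))
      (λ x y → α , λ β p → A.trans β (thread-at α β p _) (A.trans β (I.∧-homo {α} {β} p x y)
        (A.sym β (A.∧-cong β (thread-at α β p x) (thread-at α β p y)))))
      (λ x → α , λ β p → A.trans β (thread-at α β p _) (A.trans β (I.¬-homo {α} {β} p x)
        (A.sym β (A.¬-cong β (thread-at α β p x)))))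
      (λ x (β , h) → let γ , p , q = beyond α β in EmbeddingKernel.kernel (I.embedding {α} {γ} p)
        (A.trans γ (A.sym γ (thread-at α γ p x)) (h γ q)))

    union-isUnion : IsUnion union
    union-isUnion = record
      { inj      = thread-embedding
      ; inj-incl = λ {α} {β} p x → β , λ γ q → A.trans γ (thread-at β γ q _)
          (A.trans γ (incl-∘ {α} {β} {γ} p q (<-trans p q) x) (A.sym γ (thread-at α γ (<-trans p q) x)))
      ; covers   = λ (s , α , x , s≈) → α , x , α , λ β p → A.trans β (thread-at α β p x) (A.sym β (s≈ β p))
      }

    module _ (A∈ : ∀ α → InBool Λ (alg α)) (D : BooleanAlgebra ℓ ℓ) (u : IsUnion D) where
      open IsUnion u
      private
        module D = BooleanAlgebra D
        module R α = Rank Λ (proj₂ (A∈ α))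

      union-nondegenerate : D.⊤ D.≉ D.⊥
      union-nondegenerate eq = proj₁ (A∈ index₀)
        (EmbeddingKernel.kernel (inj index₀) (D.trans (Embedding.⊤-homo (inj index₀)) eq))

      Code : D.Carrier → Segment δ × Ord → Set ℓ
      Code y (α , ξ) = ∃[ x ] (Embedding.to (inj α) x D.≈ y × R.rank α x ≡ ξ)

      -- An element is coded by an index and the rank of a preimage there; regularity bounds all
      -- these ranks by one γ. The pair must be chosen to respect equality in D, hence extensional
      -- choice.
      union-small : Small Λ D.setoid
      union-small = small-↪ code-injection (small-× segment-small (γ , record { to = λ ξ → ξ ; cong = λ eq → eq ; injective = λ eq → eq }))
        where
        coding = choice D.setoid (Segment δ × Ord) Code
          (λ { y≈y′ (x , p , q) → x , D.trans p y≈y′ , q })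
          (λ y → let α , x , p = covers y in (α , R.rank α x) , x , p , ≡.refl)
        code = proj₁ coding
        ranks-bounded = IsStronglyInaccessible.isRegular inacc δ (λ α → R.bound α)
        γ = proj₁ ranks-bounded
        segment-small : Small Λ (≡.setoid (Segment δ))
        segment-small = δ , record { to = λ ξ → ξ ; cong = λ eq → eq ; injective = λ eq → eq }
        code< : ∀ y → proj₂ (code y) < γ
        code< y = let x , _ , eq = proj₂ (proj₂ coding) y
                      α = proj₁ (code y)
                  in <-trans (≡.subst (_< R.bound α) eq (R.rank<bound α x)) (proj₂ ranks-bounded α)
        code-injective : ∀ {y z} → code y ≡ code z → y D.≈ z
        code-injective {y} {z} eq =
          let x , p , q = proj₂ (proj₂ coding) y
              x′ , p′ , q′ = ≡.subst (Code z) (≡.sym eq) (proj₂ (proj₂ coding) z)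
              α = proj₁ (code y)
          in D.trans (D.sym p) (D.trans (Embedding.⟦⟧-cong (inj α) (R.rank-injective α (≡.trans q (≡.sym q′)))) p′)
        code-injection : Injection D.setoid (≡.setoid (Segment δ × Segment γ))
        code-injection = record
          { to        = λ y → proj₁ (code y) , (proj₂ (code y) , code< y)
          ; cong      = λ y≈z → ≡.cong₂ _,_ (≡.cong proj₁ (proj₁ (proj₂ coding) y≈z))
                                  (segment-injective (≡.cong proj₂ (proj₁ (proj₂ coding) y≈z)))
          ; injective = λ eq → code-injective (≡.cong₂ _,_ (≡.cong proj₁ eq) (≡.cong (proj₁ ∘ proj₂) eq))
          }

      -- A representative of d is moved to a stage beyond α, where regularity of the transition map
      -- gives the reduction; injectivity of the map into D transfers disjointness.
      union-reductions : ∀ α → Reductions (inj α)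
      union-reductions α d d≉⊥ =
        let β , y , y↦d = covers d
            γ , p , q = beyond α β
            module J = Embedding (inj γ)
            y′ = I.to {β} {γ} q y
            y′↦d = D.trans (inj-incl {β} {γ} q y) y↦d
            a , a≉⊥ , red = RegularEmbeddings.reductions em Λ (proj₂ (A∈ α)) (incl {α} {γ} p) y′
              (λ y′≈⊥ → d≉⊥ (D.trans (D.sym y′↦d) (D.trans (J.⟦⟧-cong y′≈⊥) J.⊥-homo)))
        in a , a≉⊥ , λ x x⊥d → red x (EmbeddingKernel.kernel (inj γ)
             (D.trans (J.∧-homo _ _) (D.trans (D.∧-cong (inj-incl {α} {γ} p x) y′↦d) x⊥d)))

  closedUnderUnions : ClosedUnderUnions Λ
  closedUnderUnions δ δ-limit A A∈ _ = (union δ δ-limit A , union-isUnion δ δ-limit A) , λ D u →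
    (union-nondegenerate δ δ-limit A A∈ D u , union-small δ δ-limit A A∈ D u) ,
    λ α → RegularEmbedding.isRegular (RegularEmbeddings.mkRegularEmbedding em
      (Sequence.IsUnion.inj u α) (union-reductions δ δ-limit A A∈ D u α))

-- Partial isomorphisms and back-and-forth

module _ {ℓ} (A B : BooleanAlgebra ℓ ℓ) where
  private
    module A = BooleanAlgebra A
    module B = BooleanAlgebra B

  -- Partial maps are kept as relations: unions of chains are existential statements, and exchanging
  -- the two sides is `flip`.
  Relation : Set (suc ℓ)
  Relation = A.Carrier → B.Carrier → Set ℓ

  infix 4 _⊆₂_ _≐₂_
  _⊆₂_ _≐₂_ : Relation → Relation → Set ℓ
  R ⊆₂ S = ∀ {x y} → R x y → S x y
  R ≐₂ S = R ⊆₂ S × S ⊆₂ R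

  record IsPartialIso (R : Relation) : Set ℓ where
    field
      respects   : ∀ {x x′ y y′} → x A.≈ x′ → y B.≈ y′ → R x y → R x′ y′
      ∨-closed   : ∀ {x x′ y y′} → R x y → R x′ y′ → R (x A.∨ x′) (y B.∨ y′)
      ∧-closed   : ∀ {x x′ y y′} → R x y → R x′ y′ → R (x A.∧ x′) (y B.∧ y′)
      ¬-closed   : ∀ {x y} → R x y → R (A.¬ x) (B.¬ y)
      ⊤-closed   : R A.⊤ B.⊤
      ⊥-closed   : R A.⊥ B.⊥
      functional : ∀ {x x′ y y′} → R x y → R x′ y′ → x A.≈ x′ → y B.≈ y′
      injective  : ∀ {x x′ y y′} → R x y → R x′ y′ → y B.≈ y′ → x A.≈ x′

    domain : Subalgebra A
    domain = record
      { member   = λ x → ∃[ y ] R x y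
      ; respects = λ x≈x′ (y , r) → y , respects x≈x′ B.refl r
      ; ∨-closed = λ (y , r) (y′ , r′) → y B.∨ y′ , ∨-closed r r′
      ; ∧-closed = λ (y , r) (y′ , r′) → y B.∧ y′ , ∧-closed r r′
      ; ¬-closed = λ (y , r) → B.¬ y , ¬-closed r
      ; ⊤-closed = B.⊤ , ⊤-closed
      ; ⊥-closed = B.⊥ , ⊥-closed
      }

flip-isPartialIso : ∀ {ℓ} {A B : BooleanAlgebra ℓ ℓ} {R} → IsPartialIso A B R → IsPartialIso B A (flip R)
flip-isPartialIso iso = record
  { respects   = flip respects
  ; ∨-closed   = ∨-closed
  ; ∧-closed   = ∧-closed
  ; ¬-closed   = ¬-closed
  ; ⊤-closed   = ⊤-closed
  ; ⊥-closed   = ⊥-closed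
  ; functional = injective
  ; injective  = functional
  }
  where open IsPartialIso iso

module BackAndForth (em : ∀ {a} → ExcludedMiddle a) (choice : ∀ {a e b r} → ExtensionalChoice a e b r)
  {ℓ} (Λ : WellOrder ℓ) (inacc : IsStronglyInaccessible Λ) where
  open Cardinals em Λ inacc
  open SmallAlgebras em Λ inacc
  open Subalgebra using (member)

  IsSmallRegular : (A : BooleanAlgebra ℓ ℓ) → Subalgebra A → Set ℓ
  IsSmallRegular A V = Small Λ (BooleanAlgebra.setoid (Subalgebra.algebra V))
                     × Regularity.HasReductions em A V (whole A)

  isSmallRegular-resp : ∀ {A V W} → member V ⊆ member W → member W ⊆ member V →
    IsSmallRegular A V → IsSmallRegular A W
  isSmallRegular-resp V⊆W W⊆V (V-small , red) =
      small-↪ (record { to = λ (x , x∈W) → x , W⊆V x∈W ; cong = λ eq → eq ; injective = λ eq → eq }) V-small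
    , λ {w} w∈ w≉⊥ → let v , v∈V , v≉⊥ , v-red = red {w} w∈ w≉⊥ in v , V⊆W v∈V , v≉⊥ , λ x∈W → v-red (W⊆V x∈W)

  record IsSmallPartialIso (A B : BooleanAlgebra ℓ ℓ) (R : Relation A B) : Set ℓ where
    field
      isPartialIso : IsPartialIso A B R
      domain-small : IsSmallRegular A (IsPartialIso.domain isPartialIso)
      range-small  : IsSmallRegular B (IsPartialIso.domain (flip-isPartialIso isPartialIso))

    open IsPartialIso isPartialIso public

  flip-isSmallPartialIso : ∀ {A B R} → IsSmallPartialIso A B R → IsSmallPartialIso B A (flip R)
  flip-isSmallPartialIso iso = record
    { isPartialIso = flip-isPartialIso isPartialIso ; domain-small = range-small ; range-small = domain-small }
    where open IsSmallPartialIso iso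

  isSmallPartialIso-resp : ∀ {A B R S} → _≐₂_ A B R S → IsSmallPartialIso A B R → IsSmallPartialIso A B S
  isSmallPartialIso-resp {A} {B} {R} {S} (R⊆S , S⊆R) iso = record
    { isPartialIso = S-iso
    ; domain-small = isSmallRegular-resp {A} {domain} {IsPartialIso.domain S-iso}
        (λ (y , r) → y , R⊆S r) (λ (y , s) → y , S⊆R s) domain-small
    ; range-small  = isSmallRegular-resp {B} {IsPartialIso.domain (flip-isPartialIso isPartialIso)}
        {IsPartialIso.domain (flip-isPartialIso S-iso)}
        (λ (x , r) → x , R⊆S r) (λ (x , s) → x , S⊆R s) range-small
    }
    where
    open IsSmallPartialIso iso
    S-iso : IsPartialIso A B S
    S-iso = record
      { respects   = λ p q s → R⊆S (respects p q (S⊆R s))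
      ; ∨-closed   = λ s s′ → R⊆S (∨-closed (S⊆R s) (S⊆R s′))
      ; ∧-closed   = λ s s′ → R⊆S (∧-closed (S⊆R s) (S⊆R s′))
      ; ¬-closed   = λ s → R⊆S (¬-closed (S⊆R s))
      ; ⊤-closed   = R⊆S ⊤-closed
      ; ⊥-closed   = R⊆S ⊥-closed
      ; functional = λ s s′ → functional (S⊆R s) (S⊆R s′)
      ; injective  = λ s s′ → injective (S⊆R s) (S⊆R s′)
      }

  module Graph {A B : BooleanAlgebra ℓ ℓ} (V : Subalgebra A) (f : Embedding (Subalgebra.algebra V) B) where
    private
      module A = BooleanAlgebra A
      module B = BooleanAlgebra B
      module V = Subalgebra V
      module f = Embedding f

    graph : Relation A B
    graph x y = Σ[ x∈V ∈ x ∈ V.member ] f.to (x , x∈V) B.≈ y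

    graph-isPartialIso : IsPartialIso A B graph
    graph-isPartialIso = record
      { respects   = λ p q (x∈V , r) → V.respects p x∈V , B.trans (f.⟦⟧-cong (A.sym p)) (B.trans r q)
      ; ∨-closed   = λ (x∈V , r) (x′∈V , r′) → V.∨-closed x∈V x′∈V , B.trans (f.∨-homo _ _) (B.∨-cong r r′)
      ; ∧-closed   = λ (x∈V , r) (x′∈V , r′) → V.∧-closed x∈V x′∈V , B.trans (f.∧-homo _ _) (B.∧-cong r r′)
      ; ¬-closed   = λ (x∈V , r) → V.¬-closed x∈V , B.trans (f.¬-homo _) (B.¬-cong r)
      ; ⊤-closed   = V.⊤-closed , f.⊤-homo
      ; ⊥-closed   = V.⊥-closed , f.⊥-homo
      ; functional = λ (_ , r) (_ , r′) eq → B.trans (B.sym r) (B.trans (f.⟦⟧-cong eq) r′)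
      ; injective  = λ (_ , r) (_ , r′) eq → f.injective (B.trans r (B.trans eq (B.sym r′)))
      }

    graph-isSmallPartialIso : IsSmallRegular A V → Reductions f → IsSmallPartialIso A B graph
    graph-isSmallPartialIso V-small f-red = record
      { isPartialIso = graph-isPartialIso
      ; domain-small = isSmallRegular-resp {A} {V} {IsPartialIso.domain graph-isPartialIso}
          (λ x∈V → _ , x∈V , B.refl) (λ (_ , x∈V , _) → x∈V) V-small
      ; range-small  = isSmallRegular-resp {B} {f.image} {IsPartialIso.domain (flip-isPartialIso graph-isPartialIso)}
          (λ ((x , x∈V) , r) → x , x∈V , r) (λ (x , x∈V , r) → (x , x∈V) , r)
          (RegularEmbeddings.image-small em Λ f (proj₁ V-small) ,
           RegularEmbeddings.reductions⇒hasReductions em f f-red {whole B})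
      }

  module Supremum (𝔸 : BooleanAlgebra ℓ ℓ) (seq : InBoolSeq Λ 𝔸) where
    open Filtration 𝔸 seq

    -- By continuity the stages below a supremum of indices exhaust the stage at the supremum.
    stage-supremum : ∀ α → ∃[ β ] β < α → (γ : ∀ β → β < α → Ord) →
      ∃[ γ* ] ((∀ β p → ¬ γ* < γ β p) ×
               (∀ {x} → x ∈ member (sub γ*) → ∃[ β ] Σ[ p ∈ β < α ] x ∈ member (sub (γ β p))))
    stage-supremum α (β₀ , β₀<α) γ =
      let γ̄ , γ<γ̄ = IsStronglyInaccessible.isRegular inacc α (λ (β , p) → γ β p)
          γ* , ub , min = least (λ ζ → ∀ β p → ¬ ζ < γ β p) (γ̄ , λ β p → <-asym (γ<γ̄ (β , p)))
      in γ* , ub , exhaust γ* min em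
      where
      exhaust : ∀ γ* → (∀ ζ → (∀ β p → ¬ ζ < γ β p) → ¬ ζ < γ*) → Dec (∃[ β ] Σ[ p ∈ β < α ] ¬ γ β p < γ*) →
        ∀ {x} → x ∈ member (sub γ*) → ∃[ β ] Σ[ p ∈ β < α ] x ∈ member (sub (γ β p))
      exhaust γ* min (yes (β , p , ≮)) x∈ = β , p , sub-≮ ≮ x∈
      exhaust γ* min (no none) x∈ =
        let ξ , ξ<γ* , x∈ξ = continuous γ* limit x∈
            β , p , ξ<γ = exceed ξ ξ<γ*
        in β , p , sub-≮ (<-asym ξ<γ) x∈ξ
        where
        γ<γ* : ∀ β p → γ β p < γ*
        γ<γ* β p = decidable-stable em λ ≮ → none (β , p , ≮)
        exceed : ∀ ξ → ξ < γ* → ∃[ β ] Σ[ p ∈ β < α ] ξ < γ β p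
        exceed ξ ξ<γ* = decidable-stable em λ never → min ξ (λ β p ξ<γ → never (β , p , ξ<γ)) ξ<γ*
        limit : IsLimit _<_ γ*
        limit = (γ β₀ β₀<α , γ<γ* β₀ β₀<α) , λ ξ ξ<γ* → let β , p , ξ<γ = exceed ξ ξ<γ* in γ β p , ξ<γ , γ<γ* β p

  module Forth (𝔸 𝔸′ : BooleanAlgebra ℓ ℓ) (seq : InBoolSeq Λ 𝔸) (inj′ : IsInjective Λ 𝔸′) where
    open Filtration 𝔸 seq
    private
      module 𝔸 = BooleanAlgebra 𝔸
      module 𝔸′ = BooleanAlgebra 𝔸′

    -- A full stage, of index at least α, is squeezed between the domains of R and S. At limits the
    -- union of the domains is then also a union of stages; beyond that, γ ≥ α makes the final map
    -- total.
    Covers : Ord → Relation 𝔸 𝔸′ → Relation 𝔸 𝔸′ → Set ℓ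
    Covers α R S = ∃[ γ ] (¬ γ < α × (∀ {x y} → R x y → x ∈ member (sub γ)) × (∀ {x} → x ∈ member (sub γ) → ∃[ y ] S x y))

    -- The domain of R is regular in `𝔸`, hence in any stage containing it, so injectivity of `𝔸′`
    -- extends R to that whole stage.
    forth : ∀ {R} → IsSmallPartialIso 𝔸 𝔸′ R → ∀ α →
      ∃[ S ] (_⊆₂_ 𝔸 𝔸′ R S × IsSmallPartialIso 𝔸 𝔸′ S × Covers α R S)
    forth {R} iso α = graph , R⊆graph
        , graph-isSmallPartialIso (proj₂ (inBool γ) , λ {w} → sub-hasReductions γ {whole 𝔸} {w})
            (RegularEmbeddings.reductions em Λ (proj₂ (inBool γ)) f̄)
        , γ , <-asym (proj₁ (proj₂ γ-exists)) , dom⊆γ , λ x∈ → RegularEmbedding.to f̄ (_ , x∈) , x∈ , 𝔸′.refl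
      where
      open IsSmallPartialIso iso
      dom-bounded : ∃[ γ ] (∀ (x : Σ 𝔸.Carrier (member domain)) → proj₁ x ∈ member (sub γ))
      dom-bounded = contains-small (proj₁ domain-small) proj₁ (λ eq → eq)
      γ-exists : ∃[ γ ] (α < γ × proj₁ dom-bounded < γ)
      γ-exists = above₂ α (proj₁ dom-bounded)
      γ : Ord
      γ = proj₁ γ-exists
      dom⊆γ : ∀ {x y} → R x y → x ∈ member (sub γ)
      dom⊆γ {x} {y} r = sub-≮ (<-asym (proj₂ (proj₂ γ-exists))) (proj₂ dom-bounded (x , y , r))
      dom : Subalgebra (stageAlgebra γ)
      dom = restrict (sub γ) domain
      dom-small : Small Λ (BooleanAlgebra.setoid (Subalgebra.algebra dom))
      dom-small = small-↪ (record { to = λ ((x , _) , d) → x , d ; cong = λ eq → eq ; injective = λ eq → eq })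
                    (proj₁ domain-small)
      dom-regular : IsRegular (stageAlgebra γ) dom
      dom-regular = Regularity.hasReductions⇒⊑ em (stageAlgebra γ) {dom} {whole (stageAlgebra γ)} _
        λ { {w , _} _ w≉⊥ → let v , (y , r) , v≉⊥ , v-red = proj₂ domain-small {w} tt w≉⊥
                            in (v , dom⊆γ r) , (y , r) , v≉⊥ , λ d → v-red d }
      f : Embedding (Subalgebra.algebra dom) 𝔸′
      f = mkEmbedding (λ (_ , y , _) → y) (λ { {_ , _ , r} {_ , _ , r′} eq → functional r r′ eq })
        (λ _ _ → 𝔸′.refl) (λ _ → 𝔸′.refl) (λ { (_ , _ , r) eq → injective r ⊥-closed eq })
      f-reductions : Reductions f
      f-reductions b b≉⊥ =
        let v , (x₀ , r₀) , v≉⊥ , v-red = proj₂ range-small {b} tt b≉⊥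
        in ((x₀ , dom⊆γ r₀) , v , r₀) , (λ x₀≈⊥ → v≉⊥ (functional r₀ ⊥-closed x₀≈⊥))
         , λ { ((x , _) , y , r) y⊥b → injective (∧-closed r r₀) ⊥-closed (v-red (x , r) y⊥b) }
      extension : _
      extension = inj′ (stageAlgebra γ) dom (proj₁ (inBool γ) , dom-small) (inBool γ) dom-regular
        (RegularEmbeddings.mkRegularEmbedding em f f-reductions)
      f̄ : RegularEmbedding (stageAlgebra γ) 𝔸′
      f̄ = proj₁ extension
      open Graph {𝔸} {𝔸′} (sub γ) (RegularEmbedding.embedding f̄)
      R⊆graph : _⊆₂_ 𝔸 𝔸′ R graph
      R⊆graph {x} {y} r = dom⊆γ r , proj₂ extension ((x , dom⊆γ r) , y , r)

  module Construction (𝔸 𝔸′ : BooleanAlgebra ℓ ℓ) (seq : InBoolSeq Λ 𝔸) (seq′ : InBoolSeq Λ 𝔸′)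
    (inj : IsInjective Λ 𝔸) (inj′ : IsInjective Λ 𝔸′)
    (I : Relation 𝔸 𝔸′) (I-iso : IsSmallPartialIso 𝔸 𝔸′ I) where
    private
      module 𝔸 = BooleanAlgebra 𝔸
      module 𝔸′ = BooleanAlgebra 𝔸′
      module F = Filtration 𝔸 seq
      module F′ = Filtration 𝔸′ seq′
      module →Forth = Forth 𝔸 𝔸′ seq inj′
      module ←Forth = Forth 𝔸′ 𝔸 seq′ inj
      Correspondence = Relation 𝔸 𝔸′
      infix 4 _⊆ᵣ_ _≐ᵣ_
      _⊆ᵣ_ = _⊆₂_ 𝔸 𝔸′
      _≐ᵣ_ = _≐₂_ 𝔸 𝔸′
      SmallIso = IsSmallPartialIso 𝔸 𝔸′

    -- The main demands are conditional on R, so that every R has an extension and choice can be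
    -- made before the recursion is known to stay within small partial isomorphisms. Inclusion is
    -- unconditional and gives monotonicity at once.
    Extends : Ord → Correspondence → Correspondence → Set ℓ
    Extends α R S = R ⊆ᵣ S × (SmallIso R → SmallIso S × →Forth.Covers α R S × ←Forth.Covers α (flip R) (flip S))

    extend : ∀ α R → ∃[ S ] Extends α R S
    extend α R = by em
      where
      by : Dec (SmallIso R) → ∃[ S ] Extends α R S
      by (no ¬iso) = R , (λ r → r) , λ iso → contradiction iso ¬iso
      by (yes iso) =
        let S , R⊆S , S-iso , γ , γ≮α , R⊆γ , γ⊆S = →Forth.forth iso α
            T , S⊆T , T-iso , γ′ , γ′≮α , S⊆γ′ , γ′⊆T = ←Forth.forth (flip-isSmallPartialIso S-iso) α
        in flip T , (λ r → S⊆T (R⊆S r)) , λ _ → flip-isSmallPartialIso T-iso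
         , (γ , γ≮α , R⊆γ , λ x∈ → let y , s = γ⊆S x∈ in y , S⊆T s)
         , (γ′ , γ′≮α , (λ r → S⊆γ′ (R⊆S r)) , γ′⊆T)

    relations : Setoid (suc ℓ) ℓ
    relations = record
      { Carrier = Ord × Correspondence
      ; _≈_ = λ (α , R) (β , S) → α ≡ β × R ≐ᵣ S
      ; isEquivalence = record
        { refl  = ≡.refl , (λ r → r) , (λ r → r)
        ; sym   = λ { (≡.refl , f , g) → ≡.refl , g , f }
        ; trans = λ { (≡.refl , f , g) (≡.refl , h , k) → ≡.refl , (λ r → h (f r)) , (λ t → g (k t)) }
        }
      }

    -- The extension must depend on R only up to ≐ᵣ, as the recursion below reaches an earlier
    -- stage through different accessibility proofs.
    step-choice : Σ[ step ∈ (Ord × Correspondence → Correspondence) ]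
      (∀ {p q} → Setoid._≈_ relations p q → step p ≡ step q) × (∀ p → Extends (proj₁ p) (proj₂ p) (step p))
    step-choice = choice relations Correspondence (λ (α , R) S → Extends α R S) Extends-resp (λ (α , R) → extend α R)
      where
      Extends-resp : ∀ {p q S} → Setoid._≈_ relations p q → Extends (proj₁ p) (proj₂ p) S → Extends (proj₁ q) (proj₂ q) S
      Extends-resp (≡.refl , R⊆R′ , R′⊆R) (R⊆S , h) = (λ r → R⊆S (R′⊆R r)) , λ iso →
        let S-iso , (γ , γ≮α , R⊆γ , γ⊆S) , (γ′ , γ′≮α , R⊆γ′ , γ′⊆S) = h (isSmallPartialIso-resp (R′⊆R , R⊆R′) iso)
        in S-iso , (γ , γ≮α , (λ r → R⊆γ (R′⊆R r)) , γ⊆S) , (γ′ , γ′≮α , (λ r → R⊆γ′ (R′⊆R r)) , γ′⊆S)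

    step : Ord → Correspondence → Correspondence
    step α R = proj₁ step-choice (α , R)

    -- Adjoining `I` at every index lets zero, successor and limit indices share one clause.
    build : ∀ α → Acc _<_ α → Correspondence
    build α (acc rs) = step α λ x y → I x y ⊎ ∃[ β ] Σ[ p ∈ β < α ] build β (rs p) x y

    stage : Ord → Correspondence
    stage α = build α (<-wellFounded α)

    UnionOver : Pred Ord ℓ → Correspondence
    UnionOver P x y = I x y ⊎ ∃[ β ] (P β × stage β x y)

    below : Ord → Correspondence
    below α = UnionOver (_< α)

    -- The arguments of `step` are only extensionally equal, but the choice function returns
    -- identical values on them, so propositional equality results.
    build-irrelevant : ∀ α a a′ → build α a ≡ build α a′
    build-irrelevant α (acc rs) (acc rs′) = proj₁ (proj₂ step-choice) (≡.refl , transfer rs rs′ , transfer rs′ rs)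
      where
      transfer : ∀ (rs rs′ : ∀ {β} → β < α → Acc _<_ β) {x y} →
        (I x y ⊎ ∃[ β ] Σ[ p ∈ β < α ] build β (rs p) x y) → (I x y ⊎ ∃[ β ] Σ[ p ∈ β < α ] build β (rs′ p) x y)
      transfer rs rs′ (inj₁ i) = inj₁ i
      transfer rs rs′ {x} {y} (inj₂ (β , p , r)) =
        inj₂ (β , p , ≡.subst (λ R → R x y) (build-irrelevant β (rs p) (rs′ p)) r)

    stage-step : ∀ α → stage α ≡ step α (below α)
    stage-step α = unfold (<-wellFounded α)
      where
      unfold : ∀ a → build α a ≡ step α (below α)
      unfold (acc rs) = proj₁ (proj₂ step-choice) (≡.refl
        , (λ { (inj₁ i) → inj₁ i
             ; {x} {y} (inj₂ (β , p , r)) → inj₂ (β , p , ≡.subst (λ R → R x y) (build-irrelevant β (rs p) (<-wellFounded β)) r) })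
        , (λ { (inj₁ i) → inj₁ i
             ; {x} {y} (inj₂ (β , p , r)) → inj₂ (β , p , ≡.subst (λ R → R x y) (build-irrelevant β (<-wellFounded β) (rs p)) r) }))

    stage-extends : ∀ α → Extends α (below α) (stage α)
    stage-extends α = ≡.subst (Extends α (below α)) (≡.sym (stage-step α)) (proj₂ (proj₂ step-choice) (α , below α))

    below⊆stage : ∀ α → below α ⊆ᵣ stage α
    below⊆stage α = proj₁ (stage-extends α)

    stage-mono : ∀ {α β} → α < β → stage α ⊆ᵣ stage β
    stage-mono {α} {β} α<β r = below⊆stage β (inj₂ (α , α<β , r))

    -- Any two pairs in a union of stages already lie in a common partial isomorphism.
    union-isPartialIso : ∀ P → (∀ β → P β → IsPartialIso 𝔸 𝔸′ (stage β)) → IsPartialIso 𝔸 𝔸′ (UnionOver P)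
    union-isPartialIso P stage-iso = record
      { respects   = λ { p q (inj₁ i) → inj₁ (I.respects p q i)
                       ; p q (inj₂ (β , pβ , r)) → inj₂ (β , pβ , IsPartialIso.respects (stage-iso β pβ) p q r) }
      ; ∨-closed   = λ u v → let W , W-iso , W⊆U , r , s = common u v in W⊆U (IsPartialIso.∨-closed W-iso r s)
      ; ∧-closed   = λ u v → let W , W-iso , W⊆U , r , s = common u v in W⊆U (IsPartialIso.∧-closed W-iso r s)
      ; ¬-closed   = λ u → let W , W-iso , W⊆U , r , _ = common u u in W⊆U (IsPartialIso.¬-closed W-iso r)
      ; ⊤-closed   = inj₁ I.⊤-closed
      ; ⊥-closed   = inj₁ I.⊥-closed
      ; functional = λ u v → let W , W-iso , _ , r , s = common u v in IsPartialIso.functional W-iso r s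
      ; injective  = λ u v → let W , W-iso , _ , r , s = common u v in IsPartialIso.injective W-iso r s
      }
      where
      module I = IsSmallPartialIso I-iso
      common : ∀ {x y x′ y′} → UnionOver P x y → UnionOver P x′ y′ →
        ∃[ W ] (IsPartialIso 𝔸 𝔸′ W × W ⊆ᵣ UnionOver P × W x y × W x′ y′)
      at : ∀ β → P β → ∀ {x y x′ y′} → stage β x y → stage β x′ y′ →
        ∃[ W ] (IsPartialIso 𝔸 𝔸′ W × W ⊆ᵣ UnionOver P × W x y × W x′ y′)
      at β pβ r s = stage β , stage-iso β pβ , (λ r → inj₂ (β , pβ , r)) , r , s
      common (inj₁ i) (inj₁ j) = I , I.isPartialIso , inj₁ , i , j
      common (inj₁ i) (inj₂ (β , pβ , s)) = at β pβ (below⊆stage β (inj₁ i)) s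
      common (inj₂ (β , pβ , r)) (inj₁ j) = at β pβ r (below⊆stage β (inj₁ j))
      common (inj₂ (β , pβ , r)) (inj₂ (γ , pγ , s)) with compare β γ
      ... | tri< β<γ _ _    = at γ pγ (stage-mono β<γ r) s
      ... | tri≈ _ ≡.refl _ = at β pβ r s
      ... | tri> _ _ γ<β    = at β pβ r (stage-mono γ<β s)

    Good : Ord → Set ℓ
    Good α = SmallIso (stage α) × →Forth.Covers α (below α) (stage α) × ←Forth.Covers α (flip (below α)) (flip (stage α))

    -- With no smaller index the union is `I`, with a largest one it is that stage. Otherwise the
    -- squeezed stages exhaust, by continuity, the stage at the supremum of their indices on either
    -- side, and this is small and regular.
    below-smallIso : ∀ α → (∀ β → β < α → Good β) → SmallIso (below α)
    below-smallIso α good = by em em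
      where
      by : Dec (∃[ β ] β < α) → Dec (∃[ β ] (β < α × ∀ ξ → ξ < α → ¬ β < ξ)) → SmallIso (below α)
      by (no none) _ = isSmallPartialIso-resp
        (inj₁ , λ { (inj₁ i) → i ; (inj₂ (β , β<α , _)) → contradiction (β , β<α) none }) I-iso
      by (yes _) (yes (β , β<α , maximal)) = isSmallPartialIso-resp
        ((λ r → inj₂ (β , β<α , r)) , λ { (inj₁ i) → below⊆stage β (inj₁ i) ; (inj₂ (ξ , ξ<α , r)) → absorb ξ ξ<α r })
        (proj₁ (good β β<α))
        where
        absorb : ∀ ξ → ξ < α → stage ξ ⊆ᵣ stage β
        absorb ξ ξ<α with compare ξ β
        ... | tri< ξ<β _ _    = stage-mono ξ<β
        ... | tri≈ _ ≡.refl _ = λ r → r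
        ... | tri> _ _ β<ξ    = contradiction β<ξ (maximal ξ ξ<α)
      by (yes (β₀ , β₀<α)) (no no-max) = record
        { isPartialIso = U-iso
        ; domain-small = isSmallRegular-resp {𝔸} {F.sub γ*} {IsPartialIso.domain U-iso}
            (λ x∈ → let β , p , x∈γ = exhaust x∈
                        y , r = proj₂ (proj₂ (proj₂ (→cover β p))) x∈γ
                    in y , inj₂ (β , p , r))
            (λ (y , u) → let β , p , u′ = earlier u
                         in F.sub-≮ (ub β p) (proj₁ (proj₂ (proj₂ (→cover β p))) u′))
            (proj₂ (F.inBool γ*) , λ {w} → F.sub-hasReductions γ* {whole 𝔸} {w})
        ; range-small  = isSmallRegular-resp {𝔸′} {F′.sub γ*′} {IsPartialIso.domain (flip-isPartialIso U-iso)}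
            (λ x∈ → let β , p , x∈γ = exhaust′ x∈
                        y , r = proj₂ (proj₂ (proj₂ (←cover β p))) x∈γ
                    in y , inj₂ (β , p , r))
            (λ (y , u) → let β , p , u′ = earlier u
                         in F′.sub-≮ (ub′ β p) (proj₁ (proj₂ (proj₂ (←cover β p))) u′))
            (proj₂ (F′.inBool γ*′) , λ {w} → F′.sub-hasReductions γ*′ {whole 𝔸′} {w})
        }
        where
        U-iso : IsPartialIso 𝔸 𝔸′ (below α)
        U-iso = union-isPartialIso (_< α) λ β β<α → IsSmallPartialIso.isPartialIso (proj₁ (good β β<α))
        →cover : ∀ β → β < α → →Forth.Covers β (below β) (stage β)
        →cover β p = proj₁ (proj₂ (good β p))
        ←cover : ∀ β → β < α → ←Forth.Covers β (flip (below β)) (flip (stage β))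
        ←cover β p = proj₂ (proj₂ (good β p))
        supremum = Supremum.stage-supremum 𝔸 seq α (β₀ , β₀<α) (λ β p → proj₁ (→cover β p))
        γ* = proj₁ supremum
        ub = proj₁ (proj₂ supremum)
        exhaust = proj₂ (proj₂ supremum)
        supremum′ = Supremum.stage-supremum 𝔸′ seq′ α (β₀ , β₀<α) (λ β p → proj₁ (←cover β p))
        γ*′ = proj₁ supremum′
        ub′ = proj₁ (proj₂ supremum′)
        exhaust′ = proj₂ (proj₂ supremum′)
        -- As no index below α is largest, a pair entering at β is already present below some later
        -- ξ < α, where it is bounded by the squeezed stage.
        earlier : ∀ {x y} → below α x y → ∃[ β ] Σ[ p ∈ β < α ] below β x y
        earlier (inj₁ i) = β₀ , β₀<α , inj₁ i
        earlier (inj₂ (β , β<α , r)) = decidable-stable em λ none → no-max (β , β<α , λ ξ ξ<α β<ξ →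
          none (ξ , ξ<α , inj₂ (β , β<ξ , r)))

    good : ∀ α → Good α
    good α = go α (<-wellFounded α)
      where
      go : ∀ α → Acc _<_ α → Good α
      go α (acc rs) = proj₂ (stage-extends α) (below-smallIso α λ β β<α → go β (rs β<α))

    limit : Correspondence
    limit = UnionOver λ _ → Unit

    limit-iso : IsPartialIso 𝔸 𝔸′ limit
    limit-iso = union-isPartialIso _ λ β _ → IsSmallPartialIso.isPartialIso (proj₁ (good β))

    limit-total : ∀ x → ∃[ y ] limit x y
    limit-total x =
      let α , x∈α = F.covers x
          γ , γ≮α , _ , γ⊆stage = proj₁ (proj₂ (good α))
          y , r = γ⊆stage (F.sub-≮ γ≮α x∈α)
      in y , inj₂ (α , tt , r)

    limit-surjective : ∀ y → ∃[ x ] limit x y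
    limit-surjective y =
      let α , y∈α = F′.covers y
          γ , γ≮α , _ , γ⊆stage = proj₂ (proj₂ (good α))
          x , r = γ⊆stage (F′.sub-≮ γ≮α y∈α)
      in x , inj₂ (α , tt , r)

    isomorphism : Isomorphism 𝔸 𝔸′
    isomorphism = record
      { embedding  = mkEmbedding g (λ {x} {y} → functional (g-rel x) (g-rel y))
          (λ x y → functional (g-rel _) (∧-closed (g-rel x) (g-rel y)) 𝔸.refl)
          (λ x → functional (g-rel _) (¬-closed (g-rel x)) 𝔸.refl)
          (λ x → injective (g-rel x) ⊥-closed)
      ; surjective = λ y → let x , r = limit-surjective y in x , λ {z} z≈x → functional (g-rel z) r z≈x
      }
      where
      open IsPartialIso limit-iso
      g : 𝔸.Carrier → 𝔸′.Carrier
      g x = proj₁ (limit-total x)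
      g-rel : ∀ x → limit x (g x)
      g-rel x = proj₂ (limit-total x)

    isomorphism-extends : ∀ {x y} → I x y → Isomorphism.to isomorphism x 𝔸′.≈ y
    isomorphism-extends {x} i = IsPartialIso.functional limit-iso (proj₂ (limit-total x)) (inj₁ i) 𝔸.refl

  -- Common form of both applications: uniqueness starts from the two-element subalgebra,
  -- homogeneity from the given isomorphism of small regular subalgebras.
  extendIsomorphism : ∀ (𝔸 𝔸′ : BooleanAlgebra ℓ ℓ) → InBoolSeq Λ 𝔸 → InBoolSeq Λ 𝔸′ →
    IsInjective Λ 𝔸 → IsInjective Λ 𝔸′ → (V : Subalgebra 𝔸) → IsSmallRegular 𝔸 V →
    (f : Embedding (Subalgebra.algebra V) 𝔸′) → Reductions f →
    Σ[ g ∈ Isomorphism 𝔸 𝔸′ ] (∀ x → BooleanAlgebra._≈_ 𝔸′ (Isomorphism.to g (proj₁ x)) (Embedding.to f x))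
  extendIsomorphism 𝔸 𝔸′ seq seq′ inj inj′ V V-small f f-red = isomorphism , λ (x , x∈V) →
      isomorphism-extends (x∈V , BooleanAlgebra.refl 𝔸′)
    where
    open Graph {𝔸} {𝔸′} V f
    open Construction 𝔸 𝔸′ seq seq′ inj inj′ graph (graph-isSmallPartialIso V-small f-red)

-- Uniqueness, homogeneity and assembly of the theorem

isomorphism-reductions : ∀ {ℓ} {A B : BooleanAlgebra ℓ ℓ} (f : Isomorphism A B) → Reductions (Isomorphism.embedding f)
isomorphism-reductions {A = A} {B} f b b≉⊥ =
  let a , fa≈b = f.surjective b
  in a , (λ a≈⊥ → b≉⊥ (B.trans (B.sym (fa≈b A.refl)) (B.trans (f.⟦⟧-cong a≈⊥) f.⊥-homo)))
   , λ x fx⊥b → EmbeddingKernel.kernel f.embedding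
       (B.trans (f.∧-homo x a) (B.trans (B.∧-congˡ (fa≈b A.refl)) fx⊥b))
  where
  module f = Isomorphism f
  module A = BooleanAlgebra A
  module B = BooleanAlgebra B

module Consequences (em : ∀ {a} → ExcludedMiddle a) (choice : ∀ {a e b r} → ExtensionalChoice a e b r)
  {ℓ} (Λ : WellOrder ℓ) (inacc : IsStronglyInaccessible Λ) where
  open BackAndForth em choice Λ inacc using (extendIsomorphism)
  open SmallAlgebras em Λ inacc using (subalgebra-small; module Filtration)

  unique : ∀ (𝔸 𝔸′ : BooleanAlgebra ℓ ℓ) → InBoolSeq Λ 𝔸 → InBoolSeq Λ 𝔸′ →
    IsInjective Λ 𝔸 → IsInjective Λ 𝔸′ → Isomorphism 𝔸 𝔸′
  unique 𝔸 𝔸′ seq seq′ inj inj′ = proj₁ (extendIsomorphism 𝔸 𝔸′ seq seq′ inj inj′ (twoElement 𝔸)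
      (Filtration.twoElement-small 𝔸 seq , λ {w} → twoElement-hasReductions {whole 𝔸} {w}) twoElement-embedding twoElement-reductions)
    where
    open TwoElement em 𝔸 𝔸′ (Filtration.nondegenerate 𝔸 seq) (Filtration.nondegenerate 𝔸′ seq′)

  homogeneous : ∀ (𝔸 : BooleanAlgebra ℓ ℓ) → InBoolSeq Λ 𝔸 → IsInjective Λ 𝔸 → IsHomogeneous Λ 𝔸
  homogeneous 𝔸 seq inj B₀ B₁ B₀-regular B₁-regular B₀-small B₁-small f =
    extendIsomorphism 𝔸 𝔸 seq seq inj inj B₀
      (B₀-small , λ {w} → SmallRegularity.⊑⇒hasReductions em Λ 𝔸 {B₀} {whole 𝔸} B₀-small B₀-regular {w})
      (inclusion B₁ ∘ₑ Isomorphism.embedding f)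
      (∘-reductions (inclusion B₁) (Isomorphism.embedding f)
        (SmallRegularity.inclusion-reductions em Λ 𝔸 B₁ B₁-small B₁-regular) (isomorphism-reductions f))

mainTheorem5 : (∀ {a : Level} → ExcludedMiddle a) →
    (∀ {a e b r : Level} → ExtensionalChoice a e b r) →
    ∀ {ℓ : Level} (Λ : WellOrder ℓ) → IsStronglyInaccessible Λ →
    IsFraïsséClass Λ ×
    (Σ[ 𝔹 ∈ BooleanAlgebra ℓ ℓ ]
    InBoolSeq Λ 𝔹 × IsInjective Λ 𝔹 ×
    (∀ 𝔹′ → InBoolSeq Λ 𝔹′ → IsInjective Λ 𝔹′ → Isomorphism 𝔹 𝔹′) ×
    IsHomogeneous Λ 𝔹)
mainTheorem5 em choice Λ inacc =
  record
    { jointEmbedding                = jointEmbedding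
    ; amalgamation                  = amalgamation
    ; closedUnderRegularSubalgebras = closedUnderRegularSubalgebras
    ; closedUnderUnions             = closedUnderUnions
    } ,
  𝔹 , 𝔹-inBoolSeq , 𝔹-injective ,
  (λ 𝔹′ seq′ inj′ → unique 𝔹 𝔹′ 𝔹-inBoolSeq seq′ 𝔹-injective inj′) ,
  homogeneous 𝔹 𝔹-inBoolSeq 𝔹-injective
  where
  open CollapseAlgebra em Λ inacc using (𝔹; 𝔹-inBoolSeq)
  open CollapseInjective em Λ inacc using (𝔹-injective)
  open SmallAlgebras.Injective em Λ inacc 𝔹 𝔹-inBoolSeq 𝔹-injective using (jointEmbedding; amalgamation)
  open Unions em choice Λ inacc using (closedUnderRegularSubalgebras; closedUnderUnions)
  open Consequences em choice Λ inacc using (unique; homogeneous)
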